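{- For the toothpick structure defined in the context, let $t(n)$ be the number of toothpicks added at stage $n$ ($n\ge1$), with $t(0)=0$. Then $t(1)=1$ and, for all $k\ge 1$, $$ t(2^k+i)=\begin{cases} 2^k, & i=0;\\ 2t(i)+t(i+1), & i=1,\ldots,2^k-1.\end{cases} $$
   Context: A toothpick is a line segment of length $1$ in the plane. The toothpick structure is built as follows. At stage $1$, place a single toothpick on the $y$-axis centered at the origin (from $(0,-\tfrac12)$ to $(0,\tfrac12)$). An end of a toothpick is exposed if that point of the plane is neither an end nor the midpoint of any other toothpick. At each subsequent stage, for every exposed toothpick end, place a toothpick centered at that end and perpendicular to the toothpick having that end. -}

module Defs where

open import Data.Bool using (Bool; true; false; _∧_; _∨_; not)
open import Data.Nat using (ℕ; zero; suc)
open import Data.Integer using (ℤ; +_; _+_; _-_)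
import Data.Integer as ℤ
open import Data.List using (List; []; _∷_; _++_; map; concatMap; length)
open import Data.Bool.ListAction using (any; all)
open import Data.Product using (_×_; _,_)
open import Relation.Nullary.Decidable using (⌊_⌋)

-- Coordinates are DOUBLED so that everything lives on the integer lattice:
-- a toothpick of length 1 has length 2 here.  The stage-1 toothpick from
-- (0,-1/2) to (0,1/2) becomes the segment from (0,-1) to (0,1).

data Orientation : Set where
  vertical horizontal : Orientation

Point : Set
Point = ℤ × ℤ

record Toothpick : Set where
  constructor pick
  field
    midpoint    : Point
    orientation : Orientation
open Toothpick public

_==ℤ_ : ℤ → ℤ → Bool
a ==ℤ b = ⌊ a ℤ.≟ b ⌋

_==P_ : Point → Point → Bool
(a , b) ==P (c , d) = (a ==ℤ c) ∧ (b ==ℤ d)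

_==O_ : Orientation → Orientation → Bool
vertical   ==O vertical   = true
horizontal ==O horizontal = true
_          ==O _          = false

_==T_ : Toothpick → Toothpick → Bool
pick p o ==T pick q r = (p ==P q) ∧ (o ==O r)

ends : Toothpick → List Point
ends (pick (x , y) vertical)   = (x , y - + 1) ∷ (x , y + + 1) ∷ []
ends (pick (x , y) horizontal) = (x - + 1 , y) ∷ (x + + 1 , y) ∷ []

touches : Point → Toothpick → Bool
touches p T = (p ==P midpoint T) ∨ any (p ==P_) (ends T)

exposed : List Toothpick → Toothpick → Point → Bool
exposed S T p = all (λ T' → (T' ==T T) ∨ not (touches p T')) S

perp : Orientation → Orientation
perp vertical   = horizontal
perp horizontal = vertical

newPicks : List Toothpick → List Toothpick
newPicks S = concatMap (λ T → map (λ p → pick p (perp (orientation T)))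
                                  (Data.List.filterᵇ (exposed S T) (ends T))) S

structure : ℕ → List Toothpick
structure zero = []
structure (suc zero) = pick (+ 0 , + 0) vertical ∷ []
structure (suc (suc n)) = structure (suc n) ++ newPicks (structure (suc n))

t : ℕ → ℕ
t zero = 0
t (suc zero) = 1
t (suc (suc n)) = length (newPicks (structure (suc n)))

module Submission where

-- In doubled coordinates, a midpoint (x , y) carries a vertical toothpick when x + y is
-- even and a horizontal one otherwise, and it can only be created by the two lattice points that
-- flank it along the perpendicular direction.  It is occupied one stage after the earlier of the
-- two if their stages differ, and never otherwise.  By reflection in both axes it is enough to know
-- the stages in one quadrant.  With N = 2 ^ k, the box x < N, y ≤ N holds exactly the points of stage
-- at most 2N there, and the box of the next size consists of this box together with three delayed
-- copies of it around the corner (N , N): two delayed by 2N, and a transposed and reflected one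
-- delayed by only 2N - 1.  Counting the points of stage 2N + i in the copies gives 2 t(i) + t(i + 1).

open import Defs
open import Data.Nat using (ℕ; suc; _+_; _*_; _^_; _≤_; _<_)
open import Data.Product using (_×_)
open import Relation.Binary.PropositionalEquality using (_≡_)
open import Data.Bool using (Bool; true; false; not; _xor_; if_then_else_; T; T?)
open import Data.Bool.ListAction using (any; all)
open import Data.Bool.Properties using (not-involutive; not-injective)
open import Data.Empty using (⊥; ⊥-elim)
open import Data.Integer using (+_; -[1+_]; ∣_∣; _◃_; sign)
import Data.Integer as ℤ
import Data.Integer.Properties as ℤₚ
open import Data.List using (List; []; _∷_; _++_; map; length; filter; filterᵇ; cartesianProduct; upTo)
open import Data.List.Membership.Propositional using (_∈_; _∉_; find; lose)
open import Data.List.Membership.Propositional.Properties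
  using (∈-map⁺; ∈-map⁻; ∈-filter⁺; ∈-filter⁻; ∈-concatMap⁺; ∈-concatMap⁻; ∈-++⁺ˡ; ∈-++⁺ʳ; ∈-++⁻;
         ∈-cartesianProduct⁺; ∈-cartesianProduct⁻; ∈-upTo⁺)
open import Data.List.Membership.Propositional.Properties.WithK using (unique∧set⇒bag)
open import Data.List.Properties using (length-map; length-++)
open import Data.List.Relation.Binary.BagAndSetEquality using (∼bag⇒↭)
open import Data.List.Relation.Binary.Permutation.Propositional.Properties using (↭-length)
open import Data.List.Relation.Unary.All using ([]; _∷_)
import Data.List.Relation.Unary.All as AllL
import Data.List.Relation.Unary.All.Properties as AllLₚ
open import Data.List.Relation.Unary.AllPairs using (AllPairs; []; _∷_)
import Data.List.Relation.Unary.AllPairs.Properties as AllPairs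
open import Data.List.Relation.Unary.Any using (Any; here; there; fromSum; toSum)
open import Data.List.Relation.Unary.Unique.Propositional using (Unique)
import Data.List.Relation.Unary.Unique.Propositional.Properties as Unique
open import Data.Maybe using (Maybe; just; nothing)
import Data.Maybe as Maybe
import Data.Maybe.Properties as Maybeₚ
open import Data.Maybe.Relation.Unary.All using (All; just; nothing)
import Data.Maybe.Relation.Unary.All as All
open import Data.Maybe.Relation.Unary.All.Properties using (map⁺)
open import Data.Maybe.Relation.Unary.Any using (just)
import Data.Maybe.Relation.Unary.Any as MAny
open import Data.Nat using (zero; _∸_; z≤n; s≤s; _≤?_; ∣_-_∣)
import Data.Nat as ℕ
open import Data.Nat.Properties
open import Data.Nat.Solver using (module +-*-Solver)
open import Data.Product using (_,_; proj₁; proj₂; ∃; ∃₂)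
open import Data.Product.Properties using (≡-dec)
open import Data.Sign using (Sign)
import Data.Sign as Sign
open import Data.Sum using (_⊎_; inj₁; inj₂; swap; [_,_]′)
open import Data.Unit using (⊤; tt)
open import Function using (_∘_; mk⇔)
open import Relation.Nullary using (¬_; Dec; yes; no)
open import Relation.Nullary.Decidable using (isYes≗does; proof)
open import Relation.Nullary.Reflects using (Reflects; ofʸ; ofⁿ; _×-reflects_; _⊎-reflects_; ¬-reflects)
open import Relation.Binary.PropositionalEquality
  using (refl; sym; trans; cong; cong₂; subst; subst₂; _≢_; module ≡-Reasoning)

-- The two delays come from the corner of the box. Its growth ends at stage 2N with, among others, a
-- horizontal toothpick at (N - 1 , N). This one plays the stage-1 toothpick of the transposed copy,
-- whence the delay 2N - 1. Its right end receives at stage 2N + 1 a vertical toothpick at (N , N),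
-- which plays the stage-1 toothpick of the two other copies, whence the delay 2N. The growth is not
-- followed stage by stage. The stages are defined by recursion over boxes and then shown to obey
-- the local birth rule; since a birth refers only to earlier stages, this rule determines the
-- structure. The difficulty lies at the seams, where a point and its parents are read from
-- different pieces. What closes the seams is the alternating pattern on the walls of a box, the
-- emptiness of the axes beyond the first toothpicks, and one coincidence between the row y = 1 and
-- the column x = 1.

-- Times and the birth rule

Time : Set
Time = Maybe ℕ

-- The smaller time plus one, but `nothing` for equal times: two ends that arrive together cover
-- each other, so neither is exposed. Recursion on both arguments suits common shifts of the two
-- times.
finite : ℕ → ℕ → Time
finite zero    zero    = nothing
finite zero    (suc n) = just 1
finite (suc m) zero    = just 1
finite (suc m) (suc n) = Maybe.map suc (finite m n)

-- `nothing` acts as an infinite time.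
birth : Time → Time → Time
birth nothing  nothing  = nothing
birth nothing  (just n) = just (suc n)
birth (just m) nothing  = just (suc m)
birth (just m) (just n) = finite m n

finite-comm : ∀ m n → finite m n ≡ finite n m
finite-comm zero    zero    = refl
finite-comm zero    (suc n) = refl
finite-comm (suc m) zero    = refl
finite-comm (suc m) (suc n) = cong (Maybe.map suc) (finite-comm m n)

finite-later : ∀ {m n} → m < n → finite m n ≡ just (suc m)
finite-later {zero}  (s≤s _)   = refl
finite-later {suc m} (s≤s m<n) = cong (Maybe.map suc) (finite-later m<n)

finite-inv : ∀ m n {s} → finite m n ≡ just s → (suc m ≡ s × m < n) ⊎ (suc n ≡ s × n < m)
finite-inv zero    (suc n) refl = inj₁ (refl , s≤s z≤n)
finite-inv (suc m) zero    refl = inj₂ (refl , s≤s z≤n)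
finite-inv (suc m) (suc n) eq with finite m n in eq′
finite-inv (suc m) (suc n) refl | just s with finite-inv m n eq′
... | inj₁ (refl , lt) = inj₁ (refl , s≤s lt)
... | inj₂ (refl , lt) = inj₂ (refl , s≤s lt)

birth-comm : ∀ s t → birth s t ≡ birth t s
birth-comm nothing  nothing  = refl
birth-comm nothing  (just n) = refl
birth-comm (just m) nothing  = refl
birth-comm (just m) (just n) = finite-comm m n

birth-same : ∀ t → birth t t ≡ nothing
birth-same nothing  = refl
birth-same (just n) = same n
  where
  same : ∀ n → finite n n ≡ nothing
  same zero    = refl
  same (suc n) = cong (Maybe.map suc) (same n)

birth-later : ∀ {m t} → All (m <_) t → birth (just m) t ≡ just (suc m)
birth-later (just m<n) = finite-later m<n
birth-later nothing    = refl

birth-inv : ∀ s t {n} → birth s t ≡ just (suc n) →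
            (s ≡ just n × All (n <_) t) ⊎ (t ≡ just n × All (n <_) s)
birth-inv nothing  (just n) refl = inj₂ (refl , nothing)
birth-inv (just m) nothing  refl = inj₁ (refl , nothing)
birth-inv (just m) (just n) eq with finite-inv m n eq
... | inj₁ (refl , lt) = inj₁ (refl , just lt)
... | inj₂ (refl , lt) = inj₂ (refl , just lt)

delay : ℕ → Time → Time
delay d = Maybe.map (_+_ d)

-- The rule only compares times, so it commutes with a common shift. This is how a delayed copy
-- inherits the rule from the original.
birth-delay : ∀ d s t → birth (delay d s) (delay d t) ≡ delay d (birth s t)
birth-delay d nothing  nothing  = refl
birth-delay d nothing  (just n) = cong just (sym (+-suc d n))
birth-delay d (just m) nothing  = cong just (sym (+-suc d m))
birth-delay d (just m) (just n) = go d
  where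
  go : ∀ d → finite (d + m) (d + n) ≡ delay d (finite m n)
  go zero    = sym (Maybeₚ.map-id (finite m n))
  go (suc d) = trans (cong (Maybe.map suc) (go d)) (sym (Maybeₚ.map-∘ (finite m n)))

delay-suc : ∀ d t → delay (suc d) t ≡ delay d (Maybe.map suc t)
delay-suc d nothing  = refl
delay-suc d (just n) = cong just (sym (+-suc d n))

-- Parity

odd : ℕ → Bool
odd zero    = false
odd (suc n) = not (odd n)

odd-even+ : ∀ m n → odd m ≡ false → odd (m + n) ≡ odd n
odd-even+ m zero    e = trans (cong odd (+-identityʳ m)) e
odd-even+ m (suc n) e = trans (cong odd (+-suc m n)) (cong not (odd-even+ m n e))

odd-complement : ∀ m n → odd (m + n) ≡ false → odd m ≡ odd n
odd-complement zero    n       e = sym e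
odd-complement (suc m) zero    e = trans (cong odd (sym (+-identityʳ (suc m)))) e
odd-complement (suc m) (suc n) e =
  cong not (odd-complement m n (trans (sym (not-involutive _)) (trans (cong odd (sym (cong suc (+-suc m n)))) e)))

odd-double : ∀ n → odd (n + n) ≡ false
odd-double zero    = refl
odd-double (suc n) = trans (cong odd (cong suc (+-suc n n))) (trans (not-involutive _) (odd-double n))

-- Recursive description of the stages in a quadrant

-- The boxes have size N = 2 ^ k = suc (width k), so that N - 1 needs no truncated subtraction.
width : ℕ → ℕ
width zero    = 0
width (suc k) = suc (width k + width k)

-- The stage at which (x , y) is occupied, or nothing when it never is or lies outside the box.
F : ℕ → ℕ → ℕ → Time
F zero 0 0 = just 1
F zero 0 1 = just 2
F zero _ _ = nothing
F (suc k) x y with y ≤? suc (width k) | x ≤? width k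
... | no  _ | _     = delay (suc (width (suc k))) (F k ∣ x - suc (width k) ∣ (y ∸ suc (width k)))
... | yes _ | yes _ = F k x y
... | yes _ | no  _ = delay (width (suc k)) (F k (suc (width k) ∸ y) (x ∸ width k))

module Step (k : ℕ) where

  w N W : ℕ
  w = width k
  N = suc w
  W = width (suc k)

  -- The row y = N goes to the lower pieces, hence `suc b`; the column x = N goes to the right
  -- pieces, hence `suc a` in `nw`. Equations such as `a + y ≡ N` stand in for subtraction.
  data Region : ℕ → ℕ → Set where
    sw : ∀ {x y} → x ≤ w → y ≤ N → Region x y
    ne : ∀ a b → Region (N + a) (N + suc b)
    nw : ∀ {x} a b → suc a + x ≡ N → Region x (N + suc b)
    se : ∀ a b {y} → a + y ≡ N → Region (N + b) y

  region : ∀ x y → Region x y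
  region x y with y ≤? N | x ≤? w
  ... | yes y≤N | yes x≤w = sw x≤w y≤N
  ... | yes y≤N | no  x≰w = subst (λ x → Region x y) (m+[n∸m]≡n (≰⇒> x≰w))
                              (se (N ∸ y) (x ∸ N) (m∸n+n≡m y≤N))
  ... | no  y≰N | yes x≤w = subst (Region x) (above (≰⇒> y≰N))
                              (nw (w ∸ x) (y ∸ suc N) (cong suc (m∸n+n≡m x≤w)))
    where
    above : N < y → N + suc (y ∸ suc N) ≡ y
    above N<y = trans (+-suc N _) (m+[n∸m]≡n N<y)
  ... | no  y≰N | no  x≰w = subst₂ Region (m+[n∸m]≡n (≰⇒> x≰w))
                              (trans (+-suc N _) (m+[n∸m]≡n (≰⇒> y≰N))) (ne (x ∸ N) (y ∸ suc N))

  F-sw : ∀ {x y} → x ≤ w → y ≤ N → F (suc k) x y ≡ F k x y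
  F-sw {x} {y} x≤w y≤N with y ≤? N | x ≤? w
  ... | yes _   | yes _   = refl
  ... | yes _   | no  x≰w = ⊥-elim (x≰w x≤w)
  ... | no  y≰N | _       = ⊥-elim (y≰N y≤N)

  F-top : ∀ x b → F (suc k) x (N + suc b) ≡ delay (suc W) (F k ∣ x - N ∣ (suc b))
  F-top x b with (N + suc b) ≤? N | x ≤? w
  ... | yes p | _ = ⊥-elim (m+1+n≰m N p)
  ... | no  _ | _ = cong (λ y → delay (suc W) (F k ∣ x - N ∣ y)) (m+n∸m≡n N (suc b))

  F-ne : ∀ a b → F (suc k) (N + a) (N + suc b) ≡ delay (suc W) (F k a (suc b))
  F-ne a b = trans (F-top (N + a) b) (cong (λ x → delay (suc W) (F k x (suc b))) (trans (∣-∣-comm (N + a) N) (∣m-m+n∣≡n N a)))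

  -- The upper copies are mirror images in the line x = N. Allowing `a = 0` covers that line too,
  -- where they agree.
  F-nw : ∀ {x} a b → a + x ≡ N → F (suc k) x (N + suc b) ≡ delay (suc W) (F k a (suc b))
  F-nw {x} a b eq = trans (F-top x b) (cong (λ x → delay (suc W) (F k x (suc b)))
    (trans (cong ∣ x -_∣ (trans (sym eq) (+-comm a x))) (∣m-m+n∣≡n x a)))

  F-se : ∀ a b {y} → a + y ≡ N → F (suc k) (N + b) y ≡ delay W (F k a (suc b))
  F-se a b {y} eq with y ≤? N | (N + b) ≤? w
  ... | no  y≰N | _     = ⊥-elim (y≰N (m+n≤o⇒n≤o a (≤-reflexive eq)))
  ... | yes _   | yes p = ⊥-elim (m+n≮m w b p)
  ... | yes _   | no  _ = cong₂ (λ x y → delay W (F k x y))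
    (trans (cong (_∸ y) (sym eq)) (m+n∸n≡m a y)) (trans (cong (_∸ w) (sym (+-suc w b))) (m+n∸m≡n w (suc b)))

open Step using (sw; ne; nw; se; region)

-- Support of a box, axes, and bounds on the stages

F-outside : ∀ k {x y} → width k < x ⊎ suc (width k) < y → F k x y ≡ nothing
F-outside zero {suc x}           (inj₁ _) = refl
F-outside zero {zero} {suc (suc y)} (inj₂ _) = refl
F-outside zero {suc x} (inj₂ _) = refl
F-outside zero {zero} {suc zero} (inj₂ (s≤s ()))
F-outside (suc k) {x} {y} out with region k x y
... | sw x≤w y≤N = ⊥-elim (absurd out)
  where
  w≤ : width k ≤ width (suc k)
  w≤ = m≤n⇒m≤1+n (m≤m+n _ _)
  absurd : ¬ (width (suc k) < x ⊎ suc (width (suc k)) < y)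
  absurd (inj₁ lt) = <⇒≱ lt (≤-trans x≤w w≤)
  absurd (inj₂ lt) = <⇒≱ lt (≤-trans y≤N (s≤s w≤))
... | ne a b = trans (Step.F-ne k a b) (cong (delay _) (F-outside k (narrow out)))
  where
  narrow : width (suc k) < suc (width k) + a ⊎ suc (width (suc k)) < suc (width k) + suc b →
           width k < a ⊎ suc (width k) < suc b
  narrow (inj₁ lt) = inj₁ (+-cancelˡ-< (suc (width k)) _ _ lt)
  narrow (inj₂ lt) = inj₂ (+-cancelˡ-< (suc (width k)) _ _ (subst (_< suc (width k) + suc b) (sym (cong suc (+-suc (width k) (width k)))) lt))
... | nw a b eq = trans (Step.F-nw k (suc a) b eq) (cong (delay _) (F-outside k (narrow out)))
  where
  narrow : width (suc k) < x ⊎ suc (width (suc k)) < suc (width k) + suc b →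
           width k < suc a ⊎ suc (width k) < suc b
  narrow (inj₁ lt) = ⊥-elim (<⇒≱ lt (≤-trans (m+n≤o⇒n≤o (suc a) (≤-reflexive eq)) (s≤s (m≤m+n _ _))))
  narrow (inj₂ lt) = inj₂ (+-cancelˡ-< (suc (width k)) _ _ (subst (_< suc (width k) + suc b) (sym (cong suc (+-suc (width k) (width k)))) lt))
... | se a b eq = trans (Step.F-se k a b eq) (cong (delay _) (F-outside k (narrow out)))
  where
  narrow : width (suc k) < suc (width k) + b ⊎ suc (width (suc k)) < y →
           width k < a ⊎ suc (width k) < suc b
  narrow (inj₁ lt) = inj₂ (s≤s (+-cancelˡ-< (suc (width k)) _ _ lt))
  narrow (inj₂ lt) = ⊥-elim (<⇒≱ lt (≤-trans (m+n≤o⇒n≤o a (≤-reflexive eq)) (s≤s (≤-trans (m≤m+n _ _) (n≤1+n _)))))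

width-mono : ∀ k → width k ≤ width (suc k)
width-mono k = m≤n⇒m≤1+n (m≤m+n _ _)

F-origin : ∀ k → F k 0 0 ≡ just 1
F-origin zero    = refl
F-origin (suc k) = trans (Step.F-sw k z≤n z≤n) (F-origin k)

F-tip : ∀ k → F k 0 1 ≡ just 2
F-tip zero    = refl
F-tip (suc k) = trans (Step.F-sw k z≤n (s≤s z≤n)) (F-tip k)

-- The only copy that reaches the row y = 0 does so along its line `a = N`, one step beyond its
-- width. The same happens to the upper left copy on the y-axis.
F-x-axis : ∀ k {x} → 0 < x → F k x 0 ≡ nothing
F-x-axis zero    {suc x} _ = refl
F-x-axis (suc k) {x} 0<x with region k x 0
... | sw x≤w y≤N = trans (Step.F-sw k x≤w y≤N) (F-x-axis k 0<x)
... | se a b eq  = trans (Step.F-se k a b eq) (cong (delay _)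
                     (F-outside k (inj₁ (≤-reflexive (trans (sym eq) (+-identityʳ a))))))

F-y-axis : ∀ k {y} → 1 < y → F k 0 y ≡ nothing
F-y-axis zero    {suc (suc y)} _ = refl
F-y-axis zero    {suc zero} (s≤s ())
F-y-axis (suc k) {y} 1<y with region k 0 y
... | sw x≤w y≤N = trans (Step.F-sw k x≤w y≤N) (F-y-axis k 1<y)
... | nw a b eq  = trans (Step.F-nw k (suc a) b eq) (cong (delay _)
                     (F-outside k (inj₁ (≤-reflexive (trans (sym eq) (+-identityʳ (suc a)))))))

F≥1 : ∀ k x y → All (1 ≤_) (F k x y)
F≥1 zero zero zero = just (s≤s z≤n)
F≥1 zero zero (suc zero) = just (s≤s z≤n)
F≥1 zero zero (suc (suc y)) = nothing
F≥1 zero (suc x) y = nothing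
F≥1 (suc k) x y with region k x y
... | sw x≤w y≤N = subst (All _) (sym (Step.F-sw k x≤w y≤N)) (F≥1 k x y)
... | ne a b     = subst (All _) (sym (Step.F-ne k a b)) (map⁺ (All.map (λ _ → s≤s z≤n) (F≥1 k a (suc b))))
... | nw a b eq  = subst (All _) (sym (Step.F-nw k (suc a) b eq)) (map⁺ (All.map (λ _ → s≤s z≤n) (F≥1 k (suc a) (suc b))))
... | se a b eq  = subst (All _) (sym (Step.F-se k a b eq)) (map⁺ (All.map (λ _ → s≤s z≤n) (F≥1 k a (suc b))))

-- Compensates for the shorter delay of the transposed copy in `F-late`: that copy uses only
-- positive second coordinates, where stages start at 2.
F-off-axis≥2 : ∀ k x y → 0 < y → All (2 ≤_) (F k x y)
F-off-axis≥2 zero zero (suc zero) _ = just (s≤s (s≤s z≤n))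
F-off-axis≥2 zero zero (suc (suc y)) _ = nothing
F-off-axis≥2 zero (suc x) y _ = nothing
F-off-axis≥2 (suc k) x y 0<y with region k x y
... | sw x≤w y≤N = subst (All _) (sym (Step.F-sw k x≤w y≤N)) (F-off-axis≥2 k x y 0<y)
... | ne a b     = subst (All _) (sym (Step.F-ne k a b)) (map⁺ (All.map (λ _ → s≤s (s≤s z≤n)) (F≥1 k a (suc b))))
... | nw a b eq  = subst (All _) (sym (Step.F-nw k (suc a) b eq)) (map⁺ (All.map (λ _ → s≤s (s≤s z≤n)) (F≥1 k (suc a) (suc b))))
... | se a b eq  = subst (All _) (sym (Step.F-se k a b eq))
                     (map⁺ (All.map (λ 2≤n → m≤n⇒m≤o+n (width (suc k)) 2≤n) (F-off-axis≥2 k a (suc b) (s≤s z≤n))))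

width+-≤ : ∀ k {n} → n ≤ suc (width k) → width k + n ≤ width (suc k)
width+-≤ k le = ≤-trans (+-monoʳ-≤ (width k) le) (≤-reflexive (+-suc (width k) (width k)))

F≤ : ∀ k x y → All (_≤ suc (width (suc k))) (F k x y)
F≤ zero zero zero = just (s≤s z≤n)
F≤ zero zero (suc zero) = just (s≤s (s≤s z≤n))
F≤ zero zero (suc (suc y)) = nothing
F≤ zero (suc x) y = nothing
F≤ (suc k) x y with region k x y
... | sw x≤w y≤N = subst (All _) (sym (Step.F-sw k x≤w y≤N))
                     (All.map (λ le → ≤-trans le (s≤s (width-mono (suc k)))) (F≤ k x y))
... | ne a b     = subst (All _) (sym (Step.F-ne k a b))
                     (map⁺ (All.map (λ le → s≤s (width+-≤ (suc k) le)) (F≤ k a (suc b))))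
... | nw a b eq  = subst (All _) (sym (Step.F-nw k (suc a) b eq))
                     (map⁺ (All.map (λ le → s≤s (width+-≤ (suc k) le)) (F≤ k (suc a) (suc b))))
... | se a b eq  = subst (All _) (sym (Step.F-se k a b eq))
                     (map⁺ (All.map (λ le → m≤n⇒m≤1+n (width+-≤ (suc k) le)) (F≤ k a (suc b))))

-- Every delay exceeds what the old box needs to finish, so enlarging the box adds no point of stage
-- at most 2N. Up to that stage one box therefore speaks for the whole quadrant.
F-late : ∀ k {x y} → width k < x ⊎ suc (width k) < y → All (suc (width (suc k)) <_) (F (suc k) x y)
F-late k {x} {y} out with region k x y
... | sw x≤w y≤N with out
...   | inj₁ lt = ⊥-elim (<⇒≱ lt x≤w)
...   | inj₂ lt = ⊥-elim (<⇒≱ lt y≤N)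
F-late k out | ne a b    = subst (All _) (sym (Step.F-ne k a b))
  (map⁺ (All.map (m<m+n (suc (width (suc k)))) (F≥1 k a (suc b))))
F-late k out | nw a b eq = subst (All _) (sym (Step.F-nw k (suc a) b eq))
  (map⁺ (All.map (m<m+n (suc (width (suc k)))) (F≥1 k (suc a) (suc b))))
F-late k out | se a b eq = subst (All _) (sym (Step.F-se k a b eq))
  (map⁺ (All.map (λ 2≤n → ≤-trans (≤-reflexive (+-comm 2 (width (suc k)))) (+-monoʳ-≤ (width (suc k)) 2≤n))
    (F-off-axis≥2 k a (suc b) (s≤s z≤n))))

nothing≢just : ∀ {n} {t : Time} → t ≡ nothing → t ≢ just n
nothing≢just refl ()

in-box? : ∀ k x y → (x ≤ width k × y ≤ suc (width k)) ⊎ (width k < x ⊎ suc (width k) < y)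
in-box? k x y with x ≤? width k | y ≤? suc (width k)
... | yes x≤w | yes y≤N = inj₁ (x≤w , y≤N)
... | no  x≰w | _       = inj₂ (inj₁ (≰⇒> x≰w))
... | yes _   | no  y≰N = inj₂ (inj₂ (≰⇒> y≰N))

F-up : ∀ k {x y n} → F k x y ≡ just n → F (suc k) x y ≡ just n
F-up k {x} {y} eq with in-box? k x y
... | inj₁ (x≤w , y≤N) = trans (Step.F-sw k x≤w y≤N) eq
... | inj₂ out         = ⊥-elim (nothing≢just (F-outside k out) eq)

F-down : ∀ k {x y n} → n ≤ suc (width (suc k)) → F (suc k) x y ≡ just n → F k x y ≡ just n
F-down k {x} {y} {n} n≤ eq with in-box? k x y
... | inj₁ (x≤w , y≤N) = trans (sym (Step.F-sw k x≤w y≤N)) eq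
... | inj₂ out         = ⊥-elim (<⇒≱ (All.drop-just (subst (All _) eq (F-late k out))) n≤)

-- The walls of a box

-- Every second point of the top row and of the right column is occupied at the end of the box's own growth
-- and the others never are, which shields the box from the copies around it.  The relation low between the
-- row y = 1 and the column x = 1 makes the two parents of each point to the right of the corner (N , N),
-- which lie in different copies, coincide in time.
record Walls (k : ℕ) : Set where
  field
    even-N    : odd (suc (width k)) ≡ false
    top-on    : ∀ {x} → x ≤ width k → odd x ≡ true → F k x (suc (width k)) ≡ just (suc (width (suc k)))
    top-off   : ∀ {x} → odd x ≡ false → F k x (suc (width k)) ≡ nothing
    right-on  : ∀ {y} → y ≤ suc (width k) → odd y ≡ true → F k (width k) y ≡ just (width (suc k))
    right-off : ∀ {y} → y ≢ suc (width k) → odd y ≡ false → F k (width k) y ≡ nothing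
    low       : ∀ {c} → odd c ≡ true → F k 1 (suc c) ≡ Maybe.map suc (F k c 1)

-- The induction starts at k = 1, since for k = 0 the size N = 1 is odd and the parity pattern
-- fails.
walls₁ : Walls 1
walls₁ = record
  { even-N = refl
  ; top-on = λ { {suc zero} _ _ → refl ; {suc (suc _)} (s≤s ()) _ }
  ; top-off = λ { {zero} _ → refl ; {suc (suc x)} _ → F-outside 1 {suc (suc x)} {2} (inj₁ (s≤s (s≤s z≤n))) }
  ; right-on = λ { {suc zero} _ _ → refl ; {suc (suc (suc _))} (s≤s (s≤s ())) _ }
  ; right-off = λ { {zero} _ _ → refl ; {suc (suc zero)} y≢N _ → ⊥-elim (y≢N refl)
                  ; {suc (suc (suc y))} _ _ → F-outside 1 {1} {suc (suc (suc y))} (inj₂ (s≤s (s≤s (s≤s z≤n)))) }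
  ; low = λ { {suc zero} _ → refl
            ; {suc (suc c)} _ → trans (F-outside 1 {1} {suc (suc (suc c))} (inj₂ (s≤s (s≤s (s≤s z≤n)))))
                                  (cong (Maybe.map suc) (sym (F-outside 1 {suc (suc c)} {1} (inj₁ (s≤s (s≤s z≤n)))))) }
  }

module Side (k : ℕ) where
  data Side : ℕ → Set where
    below : ∀ {x} a → x ≤ width k → a + x ≡ suc (width k) → Side x
    above : ∀ a → Side (suc (width k) + a)

  data Height : ℕ → Set where
    below : ∀ {y} a → y ≤ suc (width k) → a + y ≡ suc (width k) → Height y
    above : ∀ b → Height (suc (width k) + suc b)

  height : ∀ y → Height y
  height y with y ≤? suc (width k)
  ... | yes y≤N = below (suc (width k) ∸ y) y≤N (m∸n+n≡m y≤N)
  ... | no  y≰N = subst Height (trans (+-suc (suc (width k)) _) (m+[n∸m]≡n (≰⇒> y≰N))) (above (y ∸ suc (suc (width k))))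

  side : ∀ x → Side x
  side x with x ≤? width k
  ... | yes x≤w = below (suc (width k) ∸ x) x≤w (m∸n+n≡m (m≤n⇒m≤1+n x≤w))
  ... | no  x≰w = subst Side (m+[n∸m]≡n (≰⇒> x≰w)) (above (x ∸ suc (width k)))

odd⇒positive : ∀ {x} → odd x ≡ true → 0 < x
odd⇒positive {suc x} _ = s≤s z≤n

complement< : ∀ {a x w} → a + x ≡ suc w → 0 < x → a ≤ w
complement< {a} {suc x} eq _ = m+n≤o⇒m≤o a (≤-reflexive (suc-injective (trans (sym (+-suc a x)) eq)))

module WallsStep (k : ℕ) (walls : Walls k) where
  open Step k hiding (sw; ne; nw; se; region) public
  open Side k public
  open Walls walls public

  1≤w : 1 ≤ w
  1≤w with w | even-N
  ... | zero  | ()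
  ... | suc _ | _ = s≤s z≤n

  odd-reflect : ∀ a x → a + x ≡ N → odd a ≡ odd x
  odd-reflect a x eq = odd-complement a x (trans (cong odd eq) even-N)

  odd-translate : ∀ a → odd (N + a) ≡ odd a
  odd-translate a = odd-even+ N a even-N

  full : suc W ≡ N + suc w
  full = cong suc (sym (+-suc w w))

  +N≡ : ∀ a → N + suc a ≡ suc (N + a)
  +N≡ a = +-suc N a

  narrow-x : ∀ {a} → N + a ≤ W → a ≤ w
  narrow-x {a} le = +-cancelˡ-≤ N a w le

  narrow-y : ∀ {b} → N + b ≤ suc W → b ≤ N
  narrow-y {b} le = +-cancelˡ-≤ N b (suc w) (subst (N + b ≤_) full le)

  -- The new top row is made of the top rows of the two upper copies, the new right column of the
  -- top row of the transposed copy and the right column of the upper right one. Translation and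
  -- reflection by the even number N preserve parity.
  walls-step : Walls (suc k)
  walls-step = record
    { even-N    = trans (cong odd full) (trans (odd-translate (suc w)) even-N)
    ; top-on    = λ {x} x≤ o → trans (cong (F (suc k) x) full) (top-on′ (side x) x≤ o)
    ; top-off   = λ {x} e → trans (cong (F (suc k) x) full) (top-off′ (side x) e)
    ; right-on  = λ {y} → right-on′ (height y)
    ; right-off = λ {y} → right-off′ (height y)
    ; low       = λ {c} → low′ (side c)
    }
    where
    top-on′ : ∀ {x} → Side x → x ≤ W → odd x ≡ true → F (suc k) x (N + suc w) ≡ just (suc (suc (W + W)))
    top-on′ {x} (below a x≤w eq) _ o = trans (F-nw a w eq) (trans
      (cong (delay (suc W)) (top-on (complement< eq (odd⇒positive o)) (trans (odd-reflect a _ eq) o)))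
      (cong just (cong suc (+-suc W W))))
    top-on′ (above a) x≤ o = trans (F-ne a w) (trans
      (cong (delay (suc W)) (top-on (narrow-x x≤) (trans (sym (odd-translate a)) o)))
      (cong just (cong suc (+-suc W W))))

    top-off′ : ∀ {x} → Side x → odd x ≡ false → F (suc k) x (N + suc w) ≡ nothing
    top-off′ (below a x≤w eq) e = trans (F-nw a w eq) (cong (delay (suc W)) (top-off (trans (odd-reflect a _ eq) e)))
    top-off′ (above a) e = trans (F-ne a w) (cong (delay (suc W)) (top-off (trans (sym (odd-translate a)) e)))

    right-on′ : ∀ {y} → Height y → y ≤ suc W → odd y ≡ true → F (suc k) (N + w) y ≡ just (suc (W + W))
    right-on′ (below a y≤N eq) _ o = trans (F-se a w eq) (trans
      (cong (delay W) (top-on (complement< eq (odd⇒positive o)) (trans (odd-reflect a _ eq) o)))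
      (cong just (+-suc W W)))
    right-on′ (above b) y≤ o = trans (F-ne w b)
      (cong (delay (suc W)) (right-on (narrow-y y≤) (trans (sym (odd-translate (suc b))) o)))

    right-off′ : ∀ {y} → Height y → y ≢ suc W → odd y ≡ false → F (suc k) (N + w) y ≡ nothing
    right-off′ (below a y≤N eq) _ e = trans (F-se a w eq) (cong (delay W) (top-off (trans (odd-reflect a _ eq) e)))
    right-off′ (above b) y≢ e = trans (F-ne w b) (cong (delay (suc W))
      (right-off (λ eq → y≢ (trans (cong (_+_ N) eq) (sym full))) (trans (sym (odd-translate (suc b))) e)))

    low′ : ∀ {c} → Side c → odd c ≡ true → F (suc k) 1 (suc c) ≡ Maybe.map suc (F (suc k) c 1)
    low′ {c} (below a c≤w eq) o = trans (F-sw 1≤w (s≤s c≤w)) (trans (low o)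
      (cong (Maybe.map suc) (sym (F-sw c≤w (s≤s z≤n)))))
    -- The column x = 1 of the upper left copy and the row y = 1 of the transposed copy both read
    -- the right column of the old box, with delays that differ by one.
    low′ (above a) o = trans (cong (F (suc k) 1) (sym (+N≡ a))) (trans (F-nw w a (+-comm w 1))
      (trans (Maybeₚ.map-∘ (F k w (suc a))) (cong (Maybe.map suc) (sym (F-se w a (+-comm w 1))))))

-- The birth rule in a quadrant

-- ∣ n - 1 ∣: the neighbour of n towards the axis of symmetry.
inward : ℕ → ℕ
inward zero    = 1
inward (suc n) = n

-- A record rather than the bare equation, so that the three times can be inferred by unification.
record Born (t t₁ t₂ : Time) : Set where
  constructor born
  field time : t ≡ birth t₁ t₂

born-comm : ∀ {t t₁ t₂} → Born t t₁ t₂ → Born t t₂ t₁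
born-comm {t₁ = t₁} {t₂} (born eq) = born (trans eq (birth-comm t₁ t₂))

born-subst : ∀ {t t₁ t₂ s s₁ s₂} → Born s s₁ s₂ → t ≡ s → t₁ ≡ s₁ → t₂ ≡ s₂ → Born t t₁ t₂
born-subst b refl refl refl = b

born-delay : ∀ d {t t₁ t₂ s s₁ s₂} → Born s s₁ s₂ →
             t ≡ delay d s → t₁ ≡ delay d s₁ → t₂ ≡ delay d s₂ → Born t t₁ t₂
born-delay d {s₁ = s₁} {s₂} (born refl) refl refl refl = born (sym (birth-delay d s₁ s₂))

unborn : ∀ {t t₁ t₂} → t ≡ nothing → t₁ ≡ t₂ → Born t t₁ t₂
unborn {t₂ = t₂} refl refl = born (sym (birth-same t₂))

-- For points on a wall: `F k` shows nothing beyond the box while `F (suc k)` shows the copies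
-- there, which arrive too late to matter.
born-late : ∀ {m t t₁ t₂ t₂′} → Born t t₁ t₂ → t ≡ just (suc m) → t₂ ≡ nothing → All (m <_) t₂′ → Born t t₁ t₂′
born-late {t₁ = just m} (born refl) refl refl late = born (sym (birth-later late))

-- The origin is excluded because its toothpick is placed by hand; with its two flanks mirror images
-- of each other, the rule would leave it empty.
record Rule (k : ℕ) : Set where
  field
    across : ∀ {x y} → x ≤ width k → y ≤ suc (width k) → 0 < x + y → odd x ≡ odd y →
             Born (F k x y) (F k (inward x) y) (F k (suc x) y)
    updown : ∀ {x y} → x ≤ width k → y ≤ suc (width k) → odd x ≡ not (odd y) →
             Born (F k x y) (F k x (inward y)) (F k x (suc y))

rule₁ : Rule 1
rule₁ = record { across = across ; updown = updown }
  where
  across : ∀ {x y} → x ≤ 1 → y ≤ 2 → 0 < x + y → odd x ≡ odd y →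
           Born (F 1 x y) (F 1 (inward x) y) (F 1 (suc x) y)
  across {zero}     {suc (suc zero)} _ _ _ _ = born refl
  across {suc zero} {suc zero}       _ _ _ _ = born refl
  across {zero}     {suc (suc (suc _))} _ (s≤s (s≤s ())) _ _
  across {suc zero} {suc (suc (suc _))} _ (s≤s (s≤s ())) _ _
  across {suc (suc _)} (s≤s ()) _ _ _

  updown : ∀ {x y} → x ≤ 1 → y ≤ 2 → odd x ≡ not (odd y) →
           Born (F 1 x y) (F 1 x (inward y)) (F 1 x (suc y))
  updown {zero}     {suc zero}       _ _ _ = born refl
  updown {suc zero} {zero}           _ _ _ = born refl
  updown {suc zero} {suc (suc zero)} _ _ _ = born refl
  updown {zero}     {suc (suc (suc _))} _ (s≤s (s≤s ())) _
  updown {suc zero} {suc (suc (suc _))} _ (s≤s (s≤s ())) _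
  updown {suc (suc _)} (s≤s ()) _ _

inward≤ : ∀ {n x} → 0 < n → x ≤ n → inward x ≤ n
inward≤ {x = zero}  0<n _  = 0<n
inward≤ {x = suc x} _   le = ≤-trans (n≤1+n x) le

module RuleStep (k : ℕ) (walls : Walls k) (rule : Rule k) where
  open WallsStep k walls
  open Rule rule

  inward-N : ∀ b → inward (N + suc b) ≡ N + b
  inward-N b = +-suc w b

  -- Only the right column has a flank outside the old box. There the parity hypothesis makes y odd,
  -- so by `right-on` the point is born at stage 2N - 1, from its left parent alone. The top row in
  -- `updown-sw` is analogous.
  across-sw : ∀ {x y} → x ≤ w → y ≤ N → 0 < x + y → odd x ≡ odd y →
              Born (F k x y) (F k (inward x) y) (F (suc k) (suc x) y)
  across-sw {x} {y} x≤w y≤N pos par with m≤n⇒m<n∨m≡n x≤w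
  ... | inj₁ x<w = born-subst (across x≤w y≤N pos par) refl refl (F-sw x<w y≤N)
  ... | inj₂ refl = born-late (across x≤w y≤N pos par)
    (right-on y≤N (trans (sym par) (trans (sym (not-involutive _)) (cong not even-N))))
    (F-outside k (inj₁ ≤-refl))
    (All.map (λ late → <-trans (s≤s (n≤1+n _)) late) (F-late k {suc w} {y} (inj₁ ≤-refl)))

  across-step : ∀ {x y} → x ≤ W → y ≤ suc W → 0 < x + y → odd x ≡ odd y →
                Born (F (suc k) x y) (F (suc k) (inward x) y) (F (suc k) (suc x) y)
  across-step {x} {y} x≤ y≤ pos par with region k x y
  ... | sw x≤w y≤N = born-subst (across-sw x≤w y≤N pos par)
                       (F-sw x≤w y≤N) (F-sw (inward≤ 1≤w x≤w) y≤N) refl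
  ... | ne a b = born-delay (suc W)
    (across (narrow-x x≤) (narrow-y y≤) (≤-trans (s≤s z≤n) (m≤n+m (suc b) a))
      (trans (sym (odd-translate a)) (trans par (odd-translate (suc b)))))
    (F-ne a b) (inner a) (trans (cong (λ x → F (suc k) x (N + suc b)) (sym (+N≡ a))) (F-ne (suc a) b))
    where
    inner : ∀ a → F (suc k) (w + a) (N + suc b) ≡ delay (suc W) (F k (inward a) (suc b))
    -- Left of the column x = N the mirror image begins, which is what `inward 0` asks for.
    inner zero    = F-nw 1 b (cong suc (+-identityʳ w))
    inner (suc a) = trans (cong (λ x → F (suc k) x (N + suc b)) (inward-N a)) (F-ne a b)
  across-step {zero} x≤ y≤ pos par | nw a b eq =
    unborn (F-y-axis (suc k) (≤-trans (s≤s 1≤w) (m≤m+n N (suc b)))) refl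
  -- Reflection exchanges the left and right parents, hence `born-comm`.
  across-step {suc x} x≤ y≤ pos par | nw a b eq = born-comm
    (born-delay (suc W)
      (across (complement< eq (s≤s z≤n)) (narrow-y y≤) (s≤s z≤n)
        (trans (odd-reflect (suc a) (suc x) eq) (trans par (odd-translate (suc b)))))
      (F-nw (suc a) b eq) (F-nw a b eq′) (F-nw (suc (suc a)) b (trans (cong suc (sym (+-suc a x))) eq)))
    where
    eq′ : a + suc (suc x) ≡ N
    eq′ = trans (+-suc a (suc x)) eq
  across-step {y = zero} x≤ y≤ pos par | se a b eq =
    unborn (F-x-axis (suc k) (s≤s z≤n))
      (trans (F-x-axis (suc k) (≤-trans 1≤w (m≤m+n w b))) (sym (F-x-axis (suc k) (s≤s z≤n))))
  -- Transposition turns this into `updown` of the old box.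
  across-step {y = suc y} x≤ y≤ pos par | se a b eq = born-delay W
    (updown (complement< eq (s≤s z≤n)) (s≤s (narrow-x x≤)) par′)
    (F-se a b eq) (inner b par′)
    (trans (cong (λ x → F (suc k) x (suc y)) (sym (+N≡ b))) (F-se a (suc b) eq))
    where
    par′ : odd a ≡ not (odd (suc b))
    par′ = trans (odd-reflect a (suc y) eq) (trans (sym par) (trans (odd-translate b) (sym (not-involutive _))))
    inner : ∀ b → odd a ≡ not (odd (suc b)) → F (suc k) (w + b) (suc y) ≡ delay W (F k a b)
    inner (suc b) _ = trans (cong (λ x → F (suc k) x (suc y)) (inward-N b)) (F-se a b eq)
    inner zero    e = trans (cong (λ x → F (suc k) x (suc y)) (+-identityʳ w))
      (trans (F-sw ≤-refl (m+n≤o⇒n≤o a (≤-reflexive eq))) (corner a eq e))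
      where
      -- The axis of the transposed copy is the right column of the old box: its origin is the
      -- corner (w , N), occupied at stage 2N = W + 1, and its other points of this parity are empty
      -- by `right-off`.
      corner : ∀ a → a + suc y ≡ N → odd a ≡ false → F k w (suc y) ≡ delay W (F k a 0)
      corner zero    refl e = trans (top-on ≤-refl (trans (sym (not-involutive _)) (cong not even-N)))
        (trans (cong just (+-comm 1 W)) (cong (delay W) (sym (F-origin k))))
      corner (suc a) eq e = trans
        (right-off (<⇒≢ (≤-trans (s≤s (m≤n+m (suc y) a)) (≤-reflexive eq)))
          (trans (sym (odd-reflect (suc a) (suc y) eq)) e))
        (cong (delay W) (sym (F-x-axis k (s≤s z≤n))))

  updown-sw : ∀ {x y} → x ≤ w → y ≤ N → odd x ≡ not (odd y) →
              Born (F k x y) (F k x (inward y)) (F (suc k) x (suc y))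
  updown-sw {x} {y} x≤w y≤N par with m≤n⇒m<n∨m≡n y≤N
  ... | inj₁ y<N  = born-subst (updown x≤w y≤N par) refl refl (F-sw x≤w y<N)
  ... | inj₂ refl = born-late (updown x≤w y≤N par)
    (top-on x≤w (trans par (cong not even-N)))
    (F-outside k (inj₂ ≤-refl))
    (All.map (<-trans (n<1+n _)) (F-late k (inj₂ ≤-refl)))

  updown-step : ∀ {x y} → x ≤ W → y ≤ suc W → odd x ≡ not (odd y) →
                Born (F (suc k) x y) (F (suc k) x (inward y)) (F (suc k) x (suc y))
  updown-step {x} {y} x≤ y≤ par with region k x y
  ... | sw x≤w y≤N = born-subst (updown-sw x≤w y≤N par)
                       (F-sw x≤w y≤N) (F-sw x≤w (inward≤ (s≤s z≤n) y≤N)) refl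
  ... | ne a b = born-delay (suc W)
    (updown (narrow-x x≤) (narrow-y y≤)
      (trans (sym (odd-translate a)) (trans par (cong not (odd-translate (suc b))))))
    (F-ne a b)
    (trans (cong (F (suc k) (N + a)) (inward-N b)) (inner b))
    (trans (cong (F (suc k) (N + a)) (sym (+N≡ (suc b)))) (F-ne a (suc b)))
    where
    -- The row y = N is read from the transposed copy but serves as the bottom row of the upper
    -- right one. At (N , N) the stage-2 tip of the former is the origin of the latter; further
    -- right both are empty.
    corner : ∀ a → delay W (F k 0 (suc a)) ≡ delay (suc W) (F k a 0)
    corner zero    = trans (cong (delay W) (F-tip k))
      (trans (cong just (+-suc W 1)) (cong (delay (suc W)) (sym (F-origin k))))
    corner (suc a) = trans (cong (delay W) (F-y-axis k (s≤s (s≤s z≤n))))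
      (cong (delay (suc W)) (sym (F-x-axis k (s≤s z≤n))))
    inner : ∀ b → F (suc k) (N + a) (N + b) ≡ delay (suc W) (F k a b)
    inner (suc b) = F-ne a b
    inner zero    = trans (F-se 0 a (+-identityʳ N)) (corner a)
  updown-step {zero} x≤ y≤ par | nw a b eq = unborn (F-y-axis (suc k) 1<y)
    (trans (F-y-axis (suc k) (subst (1 <_) (sym (inward-N b)) (≤-trans (s≤s 1≤w) (m≤m+n N b))))
      (sym (F-y-axis (suc k) (m≤n⇒m≤1+n 1<y))))
    where
    1<y : 1 < N + suc b
    1<y = ≤-trans (s≤s 1≤w) (m≤m+n N (suc b))
  updown-step {suc x} x≤ y≤ par | nw a b eq = born-delay (suc W)
    (updown a≤w (narrow-y y≤) par′)
    (F-nw (suc a) b eq)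
    (trans (cong (F (suc k) (suc x)) (inward-N b)) (inner b par′))
    (trans (cong (F (suc k) (suc x)) (sym (+N≡ (suc b)))) (F-nw (suc a) (suc b) eq))
    where
    a≤w : suc a ≤ w
    a≤w = complement< eq (s≤s z≤n)
    par′ : odd (suc a) ≡ not (odd (suc b))
    par′ = trans (odd-reflect (suc a) (suc x) eq) (trans par (cong not (odd-translate (suc b))))
    inner : ∀ b → odd (suc a) ≡ not (odd (suc b)) → F (suc k) (suc x) (N + b) ≡ delay (suc W) (F k (suc a) b)
    inner (suc b) _ = F-nw (suc a) b eq
    -- The bottom row of the upper left copy is the top row of the old box. The parity makes x even,
    -- so `top-off` leaves the point as empty as the copy's axis.
    inner zero    e = trans (cong (F (suc k) (suc x)) (+-identityʳ N))
      (trans (F-sw (m+n≤o⇒n≤o a (≤-reflexive (suc-injective eq))) ≤-refl)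
      (trans (top-off (trans (sym (odd-reflect (suc a) (suc x) eq)) e))
        (cong (delay (suc W)) (sym (F-x-axis k (s≤s z≤n))))))
  updown-step {y = zero} x≤ y≤ par | se a b eq = unborn (F-x-axis (suc k) (s≤s z≤n)) refl
  updown-step {y = suc y} x≤ y≤ par | se a b eq = born-comm
    (born-delay W (across (complement< eq (s≤s z≤n)) (s≤s (narrow-x x≤))
        (≤-trans (s≤s z≤n) (m≤n+m (suc b) a)) par′)
      (F-se a b eq) (outer a eq par′) (F-se (suc a) b (trans (sym (+-suc a y)) eq)))
    where
    par′ : odd a ≡ odd (suc b)
    par′ = trans (odd-reflect a (suc y) eq) (trans (sym (not-involutive _))
      (cong not (trans (sym par) (odd-translate b))))
    outer : ∀ a → a + suc y ≡ N → odd a ≡ odd (suc b) →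
            F (suc k) (N + b) (suc (suc y)) ≡ delay W (F k (inward a) (suc b))
    outer (suc a) eq _ = F-se a b (trans (+-suc a (suc y)) eq)
    -- The upper parent already lies in the upper right copy; `low` identifies its time with that of
    -- the mirror image which the transposed copy expects.
    outer zero refl e = trans (cong (F (suc k) (N + b)) (+-comm 1 N)) (trans (F-ne b 0)
      (trans (delay-suc W (F k b 1)) (cong (delay W) (sym (low (not-injective (sym e)))))))

  rule-step : Rule (suc k)
  rule-step = record { across = across-step ; updown = updown-step }

walls : ∀ k → Walls (suc k)
walls zero    = walls₁
walls (suc k) = WallsStep.walls-step (suc k) (walls k)

rules : ∀ k → Rule (suc k)
rules zero    = rule₁
rules (suc k) = RuleStep.rule-step (suc k) (walls k) (rules k)

-- From boxes to the whole quadrant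

n≤width : ∀ n → n ≤ width n
n≤width zero    = z≤n
n≤width (suc n) = s≤s (≤-trans (n≤width n) (m≤m+n _ _))

width-+ : ∀ j k → width k ≤ width (j + k)
width-+ zero    k = ≤-refl
width-+ (suc j) k = ≤-trans (width-+ j k) (width-mono (j + k))

-- The value stabilises once the box contains the point; the index x + y is large enough because n
-- is at most 2 ^ n - 1.
τ : ℕ → ℕ → Time
τ x y = F (x + y) x y

F-stable : ∀ j x y → F (j + (x + y)) x y ≡ τ x y
F-stable zero    x y = refl
F-stable (suc j) x y = trans (Step.F-sw (j + (x + y)) (≤-trans (m≤m+n x y) in-box)
                              (m≤n⇒m≤1+n (≤-trans (m≤n+m y x) in-box))) (F-stable j x y)
  where
  in-box : x + y ≤ width (j + (x + y))
  in-box = ≤-trans (n≤width (x + y)) (width-+ j (x + y))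

F≡τ : ∀ {k} x y → x + y ≤ k → F k x y ≡ τ x y
F≡τ {k} x y le = trans (cong (λ k → F k x y) (sym (m∸n+n≡m le))) (F-stable (k ∸ (x + y)) x y)

F⇒τ : ∀ k {x y n} → F k x y ≡ just n → τ x y ≡ just n
F⇒τ k {x} {y} {n} eq = trans (sym (F≡τ x y (m≤m+n (x + y) k))) (lift (x + y))
  where
  lift : ∀ j → F (j + k) x y ≡ just n
  lift zero    = eq
  lift (suc j) = F-up (j + k) (lift j)

τ⇒F : ∀ k {x y n} → n ≤ suc (width (suc k)) → τ x y ≡ just n → F k x y ≡ just n
τ⇒F k {x} {y} {n} n≤ eq = drop (x + y) (trans (F≡τ x y (m≤m+n (x + y) k)) eq)
  where
  drop : ∀ j → F (j + k) x y ≡ just n → F k x y ≡ just n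
  drop zero    eq = eq
  drop (suc j) eq = drop j (F-down (j + k) (≤-trans n≤ (s≤s bound)) eq)
    where
    bound : width (suc k) ≤ width (suc (j + k))
    bound = subst (λ m → width (suc k) ≤ width m) (+-suc j k) (width-+ j (suc k))

inward≤suc : ∀ n → inward n ≤ suc n
inward≤suc zero    = s≤s z≤n
inward≤suc (suc n) = m≤n⇒m≤1+n (n≤1+n n)

τ-across : ∀ x y → 0 < x + y → odd x ≡ odd y → Born (τ x y) (τ (inward x) y) (τ (suc x) y)
τ-across x y pos par = born-subst
  (Rule.across (rules (x + y)) (≤-trans (m≤m+n x y) in-box) (m≤n⇒m≤1+n (≤-trans (m≤n+m y x) in-box)) pos par)
  (sym (F≡τ x y (n≤1+n (x + y)))) (sym (F≡τ (inward x) y (+-monoˡ-≤ y (inward≤suc x)))) refl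
  where
  in-box : x + y ≤ width (suc (x + y))
  in-box = ≤-trans (n≤1+n _) (n≤width (suc (x + y)))

τ-updown : ∀ x y → odd x ≡ not (odd y) → Born (τ x y) (τ x (inward y)) (τ x (suc y))
τ-updown x y par = born-subst
  (Rule.updown (rules (x + y)) (≤-trans (m≤m+n x y) in-box) (m≤n⇒m≤1+n (≤-trans (m≤n+m y x) in-box)) par)
  (sym (F≡τ x y (n≤1+n (x + y))))
  (sym (F≡τ x (inward y) (≤-trans (+-monoʳ-≤ x (inward≤suc y)) (≤-reflexive (+-suc x y)))))
  (sym (F≡τ x (suc y) (≤-reflexive (+-suc x y))))
  where
  in-box : x + y ≤ width (suc (x + y))
  in-box = ≤-trans (n≤1+n _) (n≤width (suc (x + y)))

-- Stages, orientations and parents in the plane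

stage : Point → Time
stage (x , y) = τ ∣ x ∣ ∣ y ∣

orient : Point → Orientation
orient (x , y) = if odd ∣ x ∣ xor odd ∣ y ∣ then horizontal else vertical

neighbours : ∀ x → (∣ x ℤ.- + 1 ∣ ≡ inward ∣ x ∣ × ∣ x ℤ.+ + 1 ∣ ≡ suc ∣ x ∣)
                 ⊎ (∣ x ℤ.- + 1 ∣ ≡ suc ∣ x ∣ × ∣ x ℤ.+ + 1 ∣ ≡ inward ∣ x ∣)
neighbours (+ zero)        = inj₁ (refl , refl)
neighbours (+ suc n)       = inj₁ (refl , +-comm (suc n) 1)
neighbours -[1+ zero ]     = inj₂ (refl , refl)
neighbours -[1+ suc n ]    = inj₂ (cong (suc ∘ suc ∘ suc) (+-identityʳ n) , refl)

odd-inward : ∀ n → odd (inward n) ≡ not (odd n)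
odd-inward zero    = refl
odd-inward (suc n) = sym (not-involutive _)

odd-neighbours : ∀ x → odd ∣ x ℤ.- + 1 ∣ ≡ not (odd ∣ x ∣) × odd ∣ x ℤ.+ + 1 ∣ ≡ not (odd ∣ x ∣)
odd-neighbours x with neighbours x
... | inj₁ (p , q) = trans (cong odd p) (odd-inward ∣ x ∣) , cong odd q
... | inj₂ (p , q) = cong odd p , trans (cong odd q) (odd-inward ∣ x ∣)

origin : Point
origin = + 0 , + 0

∣x∣+∣y∣>0 : ∀ x y → (x , y) ≢ origin → 0 < ∣ x ∣ + ∣ y ∣
∣x∣+∣y∣>0 (+ zero)  (+ zero)  x≢o = ⊥-elim (x≢o refl)
∣x∣+∣y∣>0 (+ zero)  (+ suc _) x≢o = s≤s z≤n
∣x∣+∣y∣>0 (+ zero)  -[1+ _ ]  x≢o = s≤s z≤n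
∣x∣+∣y∣>0 (+ suc _) _         x≢o = s≤s z≤n
∣x∣+∣y∣>0 -[1+ _ ]  _         x≢o = s≤s z≤n

xor-false : ∀ a b → a xor b ≡ false → a ≡ b
xor-false true  true  _ = refl
xor-false false false _ = refl

xor-true : ∀ a b → a xor b ≡ true → a ≡ not b
xor-true true  false _ = refl
xor-true false true  _ = refl

perp-involutive : ∀ o → perp (perp o) ≡ o
perp-involutive vertical   = refl
perp-involutive horizontal = refl

orient-flipˣ : ∀ x x′ y → odd ∣ x′ ∣ ≡ not (odd ∣ x ∣) → orient (x′ , y) ≡ perp (orient (x , y))
orient-flipˣ x x′ y eq with odd ∣ x′ ∣ | odd ∣ x ∣ | odd ∣ y ∣
orient-flipˣ x x′ y refl | _ | true  | true  = refl
orient-flipˣ x x′ y refl | _ | true  | false = refl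
orient-flipˣ x x′ y refl | _ | false | true  = refl
orient-flipˣ x x′ y refl | _ | false | false = refl

orient-flipʸ : ∀ x y y′ → odd ∣ y′ ∣ ≡ not (odd ∣ y ∣) → orient (x , y′) ≡ perp (orient (x , y))
orient-flipʸ x y y′ eq with odd ∣ x ∣ | odd ∣ y′ ∣ | odd ∣ y ∣
orient-flipʸ x y y′ refl | true  | _ | true  = refl
orient-flipʸ x y y′ refl | true  | _ | false = refl
orient-flipʸ x y y′ refl | false | _ | true  = refl
orient-flipʸ x y y′ refl | false | _ | false = refl

-- A step to an end changes one coordinate by 1, hence the parity of x + y.
ends-orient : ∀ {p} q o → p ∈ ends (pick q o) → orient p ≡ perp (orient q)
ends-orient (x , y) vertical   (here refl)         = orient-flipʸ x y (y ℤ.- + 1) (proj₁ (odd-neighbours y))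
ends-orient (x , y) vertical   (there (here refl)) = orient-flipʸ x y (y ℤ.+ + 1) (proj₂ (odd-neighbours y))
ends-orient (x , y) horizontal (here refl)         = orient-flipˣ x (x ℤ.- + 1) y (proj₁ (odd-neighbours x))
ends-orient (x , y) horizontal (there (here refl)) = orient-flipˣ x (x ℤ.+ + 1) y (proj₂ (odd-neighbours x))

x-1+1 : ∀ x → x ≡ x ℤ.- + 1 ℤ.+ + 1
x-1+1 x = sym (trans (ℤₚ.+-assoc x (ℤ.- + 1) (+ 1)) (ℤₚ.+-identityʳ x))

x+1-1 : ∀ x → x ≡ x ℤ.+ + 1 ℤ.- + 1
x+1-1 x = sym (trans (ℤₚ.+-assoc x (+ 1) (ℤ.- + 1)) (ℤₚ.+-identityʳ x))

ends-sym : ∀ {p} q o → p ∈ ends (pick q o) → q ∈ ends (pick p o)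
ends-sym (x , y) vertical   (here refl)         = there (here (cong (x ,_) (x-1+1 y)))
ends-sym (x , y) vertical   (there (here refl)) = here (cong (x ,_) (x+1-1 y))
ends-sym (x , y) horizontal (here refl)         = there (here (cong (_, y) (x-1+1 x)))
ends-sym (x , y) horizontal (there (here refl)) = here (cong (_, y) (x+1-1 x))

perp-≢ : ∀ o → o ≢ perp o
perp-≢ vertical   ()
perp-≢ horizontal ()

midpoint∉ends : ∀ q o → q ∉ ends (pick q o)
midpoint∉ends q o q∈ = perp-≢ (orient q) (ends-orient q o q∈)

x-1≢x+1 : ∀ x → x ℤ.- + 1 ≢ x ℤ.+ + 1
x-1≢x+1 x = ℤₚ.<⇒≢ (ℤₚ.+-monoʳ-< x ℤ.-<+)

ends-unique : ∀ S → Unique (ends S)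
ends-unique (pick (x , y) vertical)   = ((x-1≢x+1 y ∘ cong proj₂) ∷ []) ∷ [] ∷ []
ends-unique (pick (x , y) horizontal) = ((x-1≢x+1 x ∘ cong proj₁) ∷ []) ∷ [] ∷ []

-- A toothpick at p has orientation orient p, so those that can create it are centred at the ends of the
-- perpendicular toothpick at p.
record Parents (p : Point) : Set where
  field
    {q₁ q₂}   : Point
    ends≡     : ends (pick p (perp (orient p))) ≡ q₁ ∷ q₂ ∷ []
    born-from : p ≢ origin → Born (stage p) (stage q₁) (stage q₂)

  private
    candidates : List Point
    candidates = ends (pick p (perp (orient p)))

  q₁∈ : q₁ ∈ candidates
  q₁∈ = subst (q₁ ∈_) (sym ends≡) (here refl)

  q₂∈ : q₂ ∈ candidates
  q₂∈ = subst (q₂ ∈_) (sym ends≡) (there (here refl))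

  only : ∀ {q} → q ∈ candidates → q ≡ q₁ ⊎ q ≡ q₂
  only {q} q∈ with subst (q ∈_) ends≡ q∈
  ... | here eq         = inj₁ eq
  ... | there (here eq) = inj₂ eq

  distinct : q₁ ≢ q₂
  distinct with (q₁≢q₂ ∷ []) ∷ _ ← subst Unique ends≡ (ends-unique (pick p (perp (orient p)))) = q₁≢q₂

parents : ∀ p → Parents p
parents (x , y) with odd ∣ x ∣ xor odd ∣ y ∣ in eq
... | false = record
  { ends≡     = cong (λ b → ends (pick (x , y) (perp (if b then horizontal else vertical)))) eq
  ; born-from = across }
  where
  across : (x , y) ≢ origin → Born (stage (x , y)) (stage (x ℤ.- + 1 , y)) (stage (x ℤ.+ + 1 , y))
  across x≢o with neighbours x | τ-across ∣ x ∣ ∣ y ∣ (∣x∣+∣y∣>0 x y x≢o) (xor-false _ _ eq)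
  ... | inj₁ (p , q) | b = born-subst b refl (cong (λ x → τ x ∣ y ∣) p) (cong (λ x → τ x ∣ y ∣) q)
  ... | inj₂ (p , q) | b = born-subst (born-comm b) refl (cong (λ x → τ x ∣ y ∣) p) (cong (λ x → τ x ∣ y ∣) q)
... | true  = record
  { ends≡     = cong (λ b → ends (pick (x , y) (perp (if b then horizontal else vertical)))) eq
  ; born-from = λ _ → updown }
  where
  updown : Born (stage (x , y)) (stage (x , y ℤ.- + 1)) (stage (x , y ℤ.+ + 1))
  updown with neighbours y | τ-updown ∣ x ∣ ∣ y ∣ (xor-true _ _ eq)
  ... | inj₁ (p , q) | b = born-subst b refl (cong (τ ∣ x ∣) p) (cong (τ ∣ x ∣) q)
  ... | inj₂ (p , q) | b = born-subst (born-comm b) refl (cong (τ ∣ x ∣) p) (cong (τ ∣ x ∣) q)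

-- Exposure as a proposition, and the list of new toothpicks

reflects-map : ∀ {A B : Set} {b} → (A → B) → (B → A) → Reflects A b → Reflects B b
reflects-map f g (ofʸ a)  = ofʸ (f a)
reflects-map f g (ofⁿ ¬a) = ofⁿ (¬a ∘ g)

reflects-sound : ∀ {A : Set} {b} → Reflects A b → T b → A
reflects-sound (ofʸ a) _ = a

reflects-complete : ∀ {A : Set} {b} → Reflects A b → A → T b
reflects-complete (ofʸ _)  _ = _
reflects-complete (ofⁿ ¬a) a = ¬a a

any-reflects : ∀ {A : Set} {P : A → Set} {f} → (∀ x → Reflects (P x) (f x)) →
               ∀ xs → Reflects (Any P xs) (any f xs)
any-reflects r []       = ofⁿ λ ()
any-reflects r (x ∷ xs) = reflects-map fromSum toSum
                            (r x ⊎-reflects any-reflects r xs)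

all-reflects : ∀ {A : Set} {P : A → Set} {f} → (∀ x → Reflects (P x) (f x)) →
               ∀ xs → Reflects (AllL.All P xs) (all f xs)
all-reflects r []       = ofʸ []
all-reflects r (x ∷ xs) = reflects-map (λ (p , ps) → p ∷ ps) (λ { (p ∷ ps) → p , ps })
                            (r x ×-reflects all-reflects r xs)

==ℤ-reflects : ∀ a b → Reflects (a ≡ b) (a ==ℤ b)
==ℤ-reflects a b = subst (Reflects (a ≡ b)) (sym (isYes≗does (a ℤ.≟ b))) (proof (a ℤ.≟ b))

==P-reflects : ∀ p q → Reflects (p ≡ q) (p ==P q)
==P-reflects (a , b) (c , d) = reflects-map (λ { (refl , refl) → refl }) (λ { refl → refl , refl })
                                 (==ℤ-reflects a c ×-reflects ==ℤ-reflects b d)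

==O-reflects : ∀ o r → Reflects (o ≡ r) (o ==O r)
==O-reflects vertical   vertical   = ofʸ refl
==O-reflects vertical   horizontal = ofⁿ λ ()
==O-reflects horizontal vertical   = ofⁿ λ ()
==O-reflects horizontal horizontal = ofʸ refl

==T-reflects : ∀ S S′ → Reflects (S ≡ S′) (S ==T S′)
==T-reflects (pick p o) (pick q r) = reflects-map (λ { (refl , refl) → refl }) (λ { refl → refl , refl })
                                       (==P-reflects p q ×-reflects ==O-reflects o r)

Touches : Point → Toothpick → Set
Touches p S = p ≡ midpoint S ⊎ p ∈ ends S

Exposed : List Toothpick → Toothpick → Point → Set
Exposed L S p = AllL.All (λ S′ → S′ ≡ S ⊎ ¬ Touches p S′) L

exposed-reflects : ∀ L S p → Reflects (Exposed L S p) (exposed L S p)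
exposed-reflects L S p = all-reflects (λ S′ → ==T-reflects S′ S ⊎-reflects ¬-reflects
  (==P-reflects p (midpoint S′) ⊎-reflects any-reflects (==P-reflects p) (ends S′))) L

∈-newPicks⁻ : ∀ {L R} → R ∈ newPicks L →
              ∃₂ λ S p → S ∈ L × p ∈ ends S × Exposed L S p × R ≡ pick p (perp (orientation S))
∈-newPicks⁻ {L} R∈ with find (∈-concatMap⁻ _ R∈)
... | S , S∈L , R∈S with ∈-map⁻ _ R∈S
...   | p , p∈ , eq with ∈-filter⁻ (T? ∘ exposed L S) {xs = ends S} p∈
...     | p∈ends , e = S , p , S∈L , p∈ends , reflects-sound (exposed-reflects L S p) e , eq

∈-newPicks⁺ : ∀ {L S p} → S ∈ L → p ∈ ends S → Exposed L S p → pick p (perp (orientation S)) ∈ newPicks L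
∈-newPicks⁺ {L} {S} {p} S∈L p∈ e = ∈-concatMap⁺ _ (lose S∈L (∈-map⁺ _
  (∈-filter⁺ (T? ∘ exposed L S) p∈ (reflects-complete (exposed-reflects L S p) e))))

allPairs-∈ : ∀ {A : Set} {R : A → A → Set} {xs} → Unique xs →
             (∀ {x y} → x ∈ xs → y ∈ xs → x ≢ y → R x y) → AllPairs R xs
allPairs-∈ [] r = []
allPairs-∈ (x≢ ∷ u) r = AllL.tabulate (λ y∈ → r (here refl) (there y∈) (AllL.lookup x≢ y∈))
                        ∷ allPairs-∈ u (λ x∈ y∈ → r (there x∈) (there y∈))

-- Two old toothpicks never create the same new one: its centre would be an end of both, hence
-- exposed for neither.
newPicks-unique : ∀ {L} → Unique L → Unique (newPicks L)
newPicks-unique {L} u = Unique.concat⁺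
  (AllLₚ.map⁺ (AllL.universal (λ S → Unique.map⁺ (cong midpoint) (Unique.filter⁺ (T? ∘ exposed L S) (ends-unique S))) L))
  (AllPairs.map⁺ (allPairs-∈ u disjoint))
  where
  disjoint : ∀ {S S′} → S ∈ L → S′ ∈ L → S ≢ S′ → ∀ {R} →
             ¬ (R ∈ map (λ p → pick p (perp (orientation S))) (filterᵇ (exposed L S) (ends S)) ×
                R ∈ map (λ p → pick p (perp (orientation S′))) (filterᵇ (exposed L S′) (ends S′)))
  disjoint {S} {S′} S∈ S′∈ S≢ (R∈ , R∈′)
    with p , p∈ , eq ← ∈-map⁻ _ R∈ | p′ , p∈′ , eq′ ← ∈-map⁻ _ R∈′
    with p∈S , e ← ∈-filter⁻ (T? ∘ exposed L S) {xs = ends S} p∈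
       | p∈S′ , _ ← ∈-filter⁻ (T? ∘ exposed L S′) {xs = ends S′} p∈′
    with refl ← cong midpoint (trans (sym eq) eq′)
    with AllL.lookup (reflects-sound (exposed-reflects L S p) e) S′∈
  ... | inj₁ S′≡S = S≢ (sym S′≡S)
  ... | inj₂ ¬t   = ¬t (inj₂ p∈S′)

-- The structure realises the stages

ByStage : ℕ → Point → Set
ByStage n p = MAny.Any (_≤ n) (stage p)

at : Point → Toothpick
at p = pick p (orient p)

record AtStage (n : ℕ) (S : Toothpick) : Set where
  constructor at-stage
  field
    {centre} : Point
    is-at    : S ≡ at centre
    staged   : stage centre ≡ just n

-- The invariant of the growth. It concerns membership only; multiplicity is left to
-- `structure-unique`.
record Captures (n : ℕ) (L : List Toothpick) : Set where
  field
    sound    : ∀ {S} → S ∈ L → S ≡ at (midpoint S) × ByStage n (midpoint S)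
    complete : ∀ {p} → ByStage n p → at p ∈ L

by-just : ∀ {n m t} → t ≡ just m → m ≤ n → MAny.Any (_≤ n) t
by-just refl le = just le

just-by : ∀ {n m t} → t ≡ just m → MAny.Any (_≤ n) t → m ≤ n
just-by refl (just le) = le

not-by : ∀ {n} t → ¬ MAny.Any (_≤ n) t → All (n <_) t
not-by nothing  _  = nothing
not-by (just m) ¬b = just (≰⇒> (¬b ∘ just))

late⇒not-by : ∀ {n t} → All (n <_) t → ¬ MAny.Any (_≤ n) t
late⇒not-by (just lt) (just le) = <⇒≱ lt le

child⇒parent : ∀ {p} q → p ∈ ends (at q) → q ∈ ends (pick p (perp (orient p)))
child⇒parent {p} q p∈ = subst (λ o → q ∈ ends (pick p o))
  (trans (sym (perp-involutive _)) (cong perp (sym (ends-orient q _ p∈)))) (ends-sym q _ p∈)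

parent⇒child : ∀ {q} p → q ∈ ends (pick p (perp (orient p))) → p ∈ ends (at q)
parent⇒child {q} p q∈ = subst (λ o → p ∈ ends (pick q o)) (sym (ends-orient p _ q∈)) (ends-sym p _ q∈)

at-perp : ∀ {p} q → p ∈ ends (at q) → pick p (perp (orient q)) ≡ at p
at-perp q p∈ = cong (pick _) (sym (ends-orient q _ p∈))

module NewPicks {n L} (0<n : 0 < n) (cap : Captures n L) where
  open Captures cap

  -- By stage n, exposure rules out both a toothpick centred at `p` and the other parent `q′`, since
  -- either would touch `p`. So `p` is born one stage after `q`, whose stage is at most n; as `p` is
  -- still missing at stage n, that of `q` is exactly n.
  exposed-parent : ∀ {p q q′} → p ≢ origin → q ≢ q′ → q′ ∈ ends (pick p (perp (orient p))) →
                   Born (stage p) (stage q) (stage q′) → ByStage n q → p ∈ ends (at q) →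
                   Exposed L (at q) p → stage p ≡ just (suc n)
  exposed-parent {p} {q} {q′} p≢ q≢ q′∈ (born eq) by p∈ e with stage q in sq | by
  ... | just m | just m≤n = trans eq′ (cong (λ m → just (suc m)) (≤-antisym m≤n (≤-pred (≰⇒> λ le → unborn-yet (by-just {t = stage p} eq′ le)))))
    where
    unborn-yet : ¬ ByStage n p
    unborn-yet by with AllL.lookup e (complete by)
    ... | inj₁ same = midpoint∉ends q _ (subst (_∈ ends (at q)) (cong midpoint same) p∈)
    ... | inj₂ ¬t   = ¬t (inj₁ refl)
    other-late : ¬ ByStage n q′
    other-late by with AllL.lookup e (complete by)
    ... | inj₁ same = q≢ (sym (cong midpoint same))
    ... | inj₂ ¬t   = ¬t (inj₂ (parent⇒child p q′∈))
    eq′ : stage p ≡ just (suc m)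
    eq′ = trans eq (birth-later (All.map (≤-trans (s≤s m≤n)) (not-by (stage q′) other-late)))

  child-stage : ∀ {p q} → ByStage n q → p ∈ ends (at q) → Exposed L (at q) p → stage p ≡ just (suc n)
  child-stage {p} {q} by p∈ e = stage-p
    where
    unborn-yet : ¬ ByStage n p
    unborn-yet by with AllL.lookup e (complete by)
    ... | inj₁ same = midpoint∉ends q _ (subst (_∈ ends (at q)) (cong midpoint same) p∈)
    ... | inj₂ ¬t   = ¬t (inj₁ refl)
    p≢ : p ≢ origin
    p≢ refl = unborn-yet (just 0<n)
    open Parents (parents p)
    stage-p : stage p ≡ just (suc n)
    stage-p with only (child⇒parent q p∈)
    ... | inj₁ refl = exposed-parent p≢ distinct q₂∈ (born-from p≢) by p∈ e
    ... | inj₂ refl = exposed-parent p≢ (distinct ∘ sym) q₁∈ (born-comm (born-from p≢)) by p∈ e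

  newPicks-sound : ∀ {R} → R ∈ newPicks L → AtStage (suc n) R
  newPicks-sound R∈ = let S , p , S∈ , p∈ , e , R≡ = ∈-newPicks⁻ R∈ ; S≡ , by = sound S∈ in
    subst (AtStage (suc n)) (sym R≡) (from S p S≡ by p∈ e)
    where
    from : ∀ S p → S ≡ at (midpoint S) → ByStage n (midpoint S) → p ∈ ends S → Exposed L S p →
           AtStage (suc n) (pick p (perp (orientation S)))
    from (pick q _) p refl by p∈ e = at-stage (at-perp q p∈) (child-stage by p∈ e)

  -- A toothpick touching `p` is either centred there, hence too late for `L`, or has `p` as an end
  -- and so is one of the two parents, of which `q′` is too late as well.
  sole-parent : ∀ {p q q′} → (∀ {r} → r ∈ ends (pick p (perp (orient p))) → r ≡ q ⊎ r ≡ q′) →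
                q ∈ ends (pick p (perp (orient p))) → stage p ≡ just (suc n) →
                stage q ≡ just n → All (n <_) (stage q′) → at p ∈ newPicks L
  sole-parent {p} {q} {q′} only q∈ sp sq late = subst (_∈ newPicks L) (at-perp q p∈)
    (∈-newPicks⁺ (complete (by-just sq ≤-refl)) p∈ (AllL.tabulate exposure))
    where
    p∈ : p ∈ ends (at q)
    p∈ = parent⇒child p q∈
    exposure : ∀ {S} → S ∈ L → S ≡ at q ⊎ ¬ Touches p S
    exposure {S} S∈ with sound S∈
    ... | S≡ , by with ≡-dec ℤ._≟_ ℤ._≟_ (midpoint S) q
    ...   | yes refl = inj₁ S≡
    ...   | no  r≢q  = inj₂ λ
      { (inj₁ refl) → 1+n≰n (just-by sp by)
      ; (inj₂ p∈S) → excluded (only (child⇒parent (midpoint S) (subst (λ S → p ∈ ends S) S≡ p∈S))) }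
      where
      excluded : ¬ (midpoint S ≡ q ⊎ midpoint S ≡ q′)
      excluded (inj₁ r≡q)  = r≢q r≡q
      excluded (inj₂ refl) = late⇒not-by late by

  newPicks-complete : ∀ {p} → stage p ≡ just (suc n) → at p ∈ newPicks L
  newPicks-complete {p} sp with birth-inv (stage q₁) (stage q₂) (trans (sym (Born.time (born-from p≢))) sp)
    where
    open Parents (parents p)
    p≢ : p ≢ origin
    p≢ refl = <⇒≢ 0<n (suc-injective (Maybeₚ.just-injective sp))
  ... | inj₁ (s₁ , late) = sole-parent only q₁∈ sp s₁ late
    where open Parents (parents p)
  ... | inj₂ (s₂ , late) = sole-parent (swap ∘ only) q₂∈ sp s₂ late
    where open Parents (parents p)

  captures-++ : Captures (suc n) (L ++ newPicks L)
  captures-++ = record { sound = sound′ ∘ ∈-++⁻ L ; complete = complete′ }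
    where
    sound′ : ∀ {S} → S ∈ L ⊎ S ∈ newPicks L → S ≡ at (midpoint S) × ByStage (suc n) (midpoint S)
    sound′ (inj₁ S∈) with sound S∈
    ... | S≡ , by = S≡ , weaken by
      where
      weaken : ∀ {t} → MAny.Any (_≤ n) t → MAny.Any (_≤ suc n) t
      weaken (just le) = just (m≤n⇒m≤1+n le)
    sound′ (inj₂ S∈) = new (newPicks-sound S∈)
      where
      new : ∀ {S} → AtStage (suc n) S → S ≡ at (midpoint S) × ByStage (suc n) (midpoint S)
      new (at-stage refl s) = refl , by-just s ≤-refl
    complete′ : ∀ {p} → ByStage (suc n) p → at p ∈ L ++ newPicks L
    complete′ {p} by with stage p in sp | by
    ... | just m | just m≤ with m≤n⇒m<n∨m≡n m≤
    ...   | inj₁ (s≤s m≤n) = ∈-++⁺ˡ (complete (by-just sp m≤n))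
    ...   | inj₂ refl      = ∈-++⁺ʳ L (newPicks-complete sp)

  old-new-disjoint : ∀ {S} → ¬ (S ∈ L × S ∈ newPicks L)
  old-new-disjoint (S∈ , S∈′) = too-late (newPicks-sound S∈′) (proj₂ (sound S∈))
    where
    too-late : ∀ {S} → AtStage (suc n) S → ¬ ByStage n (midpoint S)
    too-late (at-stage refl s) by = 1+n≰n (just-by s by)

captures₁ : Captures 1 (structure 1)
captures₁ = record { sound = λ { (here refl) → refl , just ≤-refl } ; complete = first }
  where
  first : ∀ {p} → ByStage 1 p → at p ∈ structure 1
  first {+ zero    , + zero}   by = here refl
  first {+ suc x   , + zero}   by = ⊥-elim (late⇒not-by (subst (All (1 <_)) (sym (F-x-axis (suc x + 0) (s≤s z≤n))) nothing) by)
  first { -[1+ x ] , + zero}   by = ⊥-elim (late⇒not-by (subst (All (1 <_)) (sym (F-x-axis (suc x + 0) (s≤s z≤n))) nothing) by)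
  first {x         , + suc y}  by = ⊥-elim (late⇒not-by (F-off-axis≥2 (∣ x ∣ + suc y) ∣ x ∣ (suc y) (s≤s z≤n)) by)
  first {x         , -[1+ y ]} by = ⊥-elim (late⇒not-by (F-off-axis≥2 (∣ x ∣ + suc y) ∣ x ∣ (suc y) (s≤s z≤n)) by)

captures : ∀ n → Captures (suc n) (structure (suc n))
captures zero    = captures₁
captures (suc n) = NewPicks.captures-++ (s≤s z≤n) (captures n)

structure-unique : ∀ n → Unique (structure (suc n))
structure-unique zero    = [] ∷ []
structure-unique (suc n) = Unique.++⁺ (structure-unique n) (newPicks-unique (structure-unique n))
                             (NewPicks.old-new-disjoint (s≤s z≤n) (captures n))

-- Counting by duplicate-free enumeration

record Count {A : Set} (P : A → Set) (c : ℕ) : Set where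
  field
    elements : List A
    unique   : Unique elements
    sound    : ∀ {x} → x ∈ elements → P x
    complete : ∀ {x} → P x → x ∈ elements
    size     : length elements ≡ c

count-injective : {A : Set} (P : A → Set) → ∀ {c d} → Count P c → Count P d → c ≡ d
count-injective P C D = trans (sym (size C)) (trans (↭-length (∼bag⇒↭ (unique∧set⇒bag (unique C) (unique D)
  (mk⇔ (complete D ∘ sound C) (complete C ∘ sound D))))) (size D))
  where open Count

module _ {A : Set} {P Q : A → Set} where
  open Count

  count-resp : ∀ {c} → (∀ {x} → P x → Q x) → (∀ {x} → Q x → P x) → Count P c → Count Q c
  count-resp f g C = record { elements = elements C ; unique = unique C
                            ; sound = f ∘ sound C ; complete = complete C ∘ g ; size = size C }

  count-⊎ : ∀ {c d} → (∀ {x} → P x → Q x → ⊥) → Count P c → Count Q d → Count (λ x → P x ⊎ Q x) (c + d)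
  count-⊎ disjoint C D = record
    { elements = elements C ++ elements D
    ; unique   = Unique.++⁺ (unique C) (unique D) (λ (x∈ , x∈′) → disjoint (sound C x∈) (sound D x∈′))
    ; sound    = λ x∈ → [ inj₁ ∘ sound C , inj₂ ∘ sound D ]′ (∈-++⁻ (elements C) x∈)
    ; complete = [ ∈-++⁺ˡ ∘ complete C , ∈-++⁺ʳ (elements C) ∘ complete D ]′
    ; size     = trans (length-++ (elements C)) (cong₂ _+_ (size C) (size D))
    }

module _ {A : Set} where

  count-none : {P : A → Set} → (∀ {x} → ¬ P x) → Count P 0
  count-none none = record { elements = [] ; unique = [] ; sound = λ () ; complete = ⊥-elim ∘ none ; size = refl }

  count-one : (a : A) → Count (_≡ a) 1
  count-one a = record { elements = a ∷ [] ; unique = [] ∷ [] ; sound = λ { (here eq) → eq }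
                       ; complete = here ; size = refl }

Image : {A B : Set} → (A → B) → (A → Set) → B → Set
Image f P y = ∃ λ x → P x × y ≡ f x

module _ {A B : Set} where
  open Count

  count-image : ∀ {P : A → Set} {c} (f : A → B) → (∀ {x y} → P x → P y → f x ≡ f y → x ≡ y) →
                Count P c → Count (Image f P) c
  count-image f inj C = record
    { elements = map f (elements C)
    ; unique   = AllPairs.map⁺ (allPairs-∈ (unique C) (λ x∈ y∈ x≢y → x≢y ∘ inj (sound C x∈) (sound C y∈)))
    ; sound    = λ y∈ → let x , x∈ , eq = ∈-map⁻ f y∈ in x , sound C x∈ , eq
    ; complete = λ { (x , px , refl) → ∈-map⁺ f (complete C px) }
    ; size     = trans (length-map f (elements C)) (size C)
    }

  length-cartesianProduct : (xs : List A) (ys : List B) → length (cartesianProduct xs ys) ≡ length xs * length ys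
  length-cartesianProduct []       ys = refl
  length-cartesianProduct (x ∷ xs) ys = trans (length-++ (map (x ,_) ys))
    (cong₂ _+_ (length-map (x ,_) ys) (length-cartesianProduct xs ys))

  count-× : ∀ {P : A → Set} {Q : B → Set} {c d} → Count P c → Count Q d → Count (λ (x , y) → P x × Q y) (c * d)
  count-× C D = record
    { elements = cartesianProduct (elements C) (elements D)
    ; unique   = Unique.cartesianProduct⁺ (unique C) (unique D)
    ; sound    = λ xy∈ → let x∈ , y∈ = ∈-cartesianProduct⁻ (elements C) (elements D) xy∈ in sound C x∈ , sound D y∈
    ; complete = λ (px , qy) → ∈-cartesianProduct⁺ (complete C px) (complete D qy)
    ; size     = trans (length-cartesianProduct (elements C) (elements D)) (cong₂ _*_ (size C) (size D))
    }

-- Counting a stage through one quadrant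

InBox : ℕ → ℕ → ℕ × ℕ → Set
InBox k n (x , y) = F k x y ≡ just n

inBox-list : ℕ → ℕ → List (ℕ × ℕ)
inBox-list k n = filter (λ (x , y) → Maybeₚ.≡-dec ℕ._≟_ (F k x y) (just n))
                        (cartesianProduct (upTo (suc (width k))) (upTo (suc (suc (width k)))))

-- The size stays the length of a search, because the recurrence only relates such numbers to each
-- other.
inBox-count : ∀ k n → Count (InBox k n) (length (inBox-list k n))
inBox-count k n = record
  { elements = inBox-list k n
  ; unique   = Unique.filter⁺ dec (Unique.cartesianProduct⁺ (Unique.upTo⁺ (suc (width k))) (Unique.upTo⁺ (suc (suc (width k)))))
  ; sound    = λ p∈ → proj₂ (∈-filter⁻ dec {xs = cartesianProduct (upTo (suc (width k))) (upTo (suc (suc (width k))))} p∈)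
  ; complete = complete
  ; size     = refl
  }
  where
  dec : (p : ℕ × ℕ) → Dec (InBox k n p)
  dec (x , y) = Maybeₚ.≡-dec ℕ._≟_ (F k x y) (just n)
  complete : ∀ {p} → InBox k n p → p ∈ inBox-list k n
  complete {x , y} eq with in-box? k x y
  ... | inj₁ (x≤w , y≤N) = ∈-filter⁺ dec (∈-cartesianProduct⁺ (∈-upTo⁺ (s≤s x≤w)) (∈-upTo⁺ (s≤s y≤N))) eq
  ... | inj₂ out         = ⊥-elim (nothing≢just (F-outside k out) eq)

delay-inv : ∀ d t {n} → delay d t ≡ just (d + n) → t ≡ just n
delay-inv d (just m) eq = cong just (+-cancelˡ-≡ d _ _ (Maybeₚ.just-injective eq))

F≡1 : ∀ k {x y} → F k x y ≡ just 1 → (x , y) ≡ (0 , 0)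
F≡1 zero {zero} {zero} _ = refl
F≡1 zero {zero} {suc zero} ()
F≡1 zero {zero} {suc (suc y)} ()
F≡1 zero {suc x} ()
F≡1 (suc k) eq = F≡1 k (F-down k (s≤s z≤n) eq)

F≡2 : ∀ k {x y} → F k x y ≡ just 2 → (x , y) ≡ (0 , 1)
F≡2 zero {zero} {zero} ()
F≡2 zero {zero} {suc zero} _ = refl
F≡2 zero {zero} {suc (suc y)} ()
F≡2 zero {suc x} ()
F≡2 (suc k) eq = F≡2 k (F-down k (s≤s (s≤s z≤n)) eq)

F≥3 : ∀ k {x y n} → 3 ≤ n → F k x y ≡ just n → 0 < x × 0 < y
F≥3 k {suc x} {suc y} 3≤n eq = s≤s z≤n , s≤s z≤n
F≥3 k {suc x} {zero}  3≤n eq = ⊥-elim (nothing≢just (F-x-axis k (s≤s z≤n)) eq)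
F≥3 k {zero} {suc (suc y)} 3≤n eq = ⊥-elim (nothing≢just (F-y-axis k (s≤s (s≤s z≤n))) eq)
F≥3 k {zero} {zero} 3≤n eq with trans (sym (F-origin k)) eq
F≥3 k {zero} {zero} (s≤s ()) eq | refl
F≥3 k {zero} {suc zero} 3≤n eq with trans (sym (F-tip k)) eq
F≥3 k {zero} {suc zero} (s≤s (s≤s ())) eq | refl

place : (Sign × Sign) × (ℕ × ℕ) → Toothpick
place ((s , r) , (x , y)) = at (s ◃ x , r ◃ y)

signs : Count {Sign × Sign} (λ _ → ⊤) 4
signs = record
  { elements = cartesianProduct (Sign.+ ∷ Sign.- ∷ []) (Sign.+ ∷ Sign.- ∷ [])
  ; unique   = Unique.cartesianProduct⁺ two two
  ; sound    = _
  ; complete = λ {(s , r)} _ → ∈-cartesianProduct⁺ (either s) (either r)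
  ; size     = refl
  }
  where
  two : Unique (Sign.+ ∷ Sign.- ∷ [])
  two = ((λ ()) ∷ []) ∷ [] ∷ []
  either : ∀ s → s ∈ Sign.+ ∷ Sign.- ∷ []
  either Sign.+ = here refl
  either Sign.- = there (here refl)

-- From stage 3 on no point lies on an axis, so the four sign choices give four different
-- toothpicks; up to stage 2N the box misses no point of its quadrant.
quadrants : ∀ k {n c} → 3 ≤ n → n ≤ suc (width (suc k)) → Count (InBox k n) c → Count (AtStage n) (4 * c)
quadrants k {n} 3≤n n≤ C = count-resp to from (count-image place injective (count-× signs C))
  where
  injective : ∀ {p q} → ⊤ × InBox k n (proj₂ p) → ⊤ × InBox k n (proj₂ q) → place p ≡ place q → p ≡ q
  injective {(s , r) , x , y} {(s′ , r′) , x′ , y′} (_ , eq) (_ , eq′) place≡ =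
    cong₂ _,_ (cong₂ _,_ (same-sign (proj₁ (F≥3 k 3≤n eq)) (proj₁ (F≥3 k 3≤n eq′)) x≡)
                         (same-sign (proj₂ (F≥3 k 3≤n eq)) (proj₂ (F≥3 k 3≤n eq′)) y≡))
              (cong₂ _,_ (same-abs s x s′ x′ x≡) (same-abs r y r′ y′ y≡))
    where
    x≡ : s ◃ x ≡ s′ ◃ x′
    x≡ = cong (proj₁ ∘ midpoint) place≡
    y≡ : r ◃ y ≡ r′ ◃ y′
    y≡ = cong (proj₂ ∘ midpoint) place≡
    same-abs : ∀ s m s′ m′ → s ◃ m ≡ s′ ◃ m′ → m ≡ m′
    same-abs s m s′ m′ eq = trans (sym (ℤₚ.abs-◃ s m)) (trans (cong ∣_∣ eq) (ℤₚ.abs-◃ s′ m′))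
    same-sign : ∀ {s m s′ m′} → 0 < m → 0 < m′ → s ◃ m ≡ s′ ◃ m′ → s ≡ s′
    same-sign {s} {suc m} {s′} {suc m′} _ _ eq =
      trans (sym (ℤₚ.sign-◃ s (suc m))) (trans (cong sign eq) (ℤₚ.sign-◃ s′ (suc m′)))
  to : ∀ {S} → Image place (λ p → ⊤ × InBox k n (proj₂ p)) S → AtStage n S
  to (((s , r) , x , y) , (_ , eq) , refl) = at-stage refl (trans (cong₂ τ (ℤₚ.abs-◃ s x) (ℤₚ.abs-◃ r y)) (F⇒τ k eq))
  from : ∀ {S} → AtStage n S → Image place (λ p → ⊤ × InBox k n (proj₂ p)) S
  from (at-stage {x , y} refl eq) = ((sign x , sign y) , ∣ x ∣ , ∣ y ∣) , (tt , τ⇒F k n≤ eq) ,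
    cong at (cong₂ _,_ (sym (ℤₚ.◃-inverse x)) (sym (ℤₚ.◃-inverse y)))

t-count : ∀ n → Count (AtStage (suc (suc n))) (t (suc (suc n)))
t-count n = record
  { elements = newPicks (structure (suc n))
  ; unique   = newPicks-unique (structure-unique n)
  ; sound    = newPicks-sound
  ; complete = λ { (at-stage refl s) → newPicks-complete s }
  ; size     = refl
  }
  where open NewPicks (s≤s z≤n) (captures n)

t≡4* : ∀ k {n c} → 3 ≤ n → n ≤ suc (width (suc k)) → Count (InBox k n) c → t n ≡ 4 * c
t≡4* k {suc (suc n)} 3≤n n≤ C = count-injective (AtStage _) (t-count n) (quadrants k 3≤n n≤ C)
t≡4* k {suc zero} (s≤s ()) _ _

-- Counting the three copies

module Doubling (k : ℕ) where
  open Step k hiding (sw; ne; nw; se; region)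

  -- `SE` reads stage `suc i` since its delay is one shorter; this is the origin of the term t(i +
  -- 1). In `NW`, `suc a` keeps the common column x = N from being counted twice.
  NE NW SE : ℕ → ℕ × ℕ → Set
  NE i p = ∃₂ λ a b → F k a (suc b) ≡ just i × p ≡ (N + a , N + suc b)
  NW i p = ∃₂ λ a b → F k (suc a) (suc b) ≡ just i × suc a ≤ N × p ≡ (N ∸ suc a , N + suc b)
  SE i p = ∃₂ λ a b → F k a (suc b) ≡ just (suc i) × a ≤ N × p ≡ (N + b , N ∸ a)

  split : ∀ {i p} → 0 < i → InBox (suc k) (suc W + i) p → NE i p ⊎ NW i p ⊎ SE i p
  split {i} {x , y} 0<i eq with region k x y
  ... | sw x≤w y≤N = ⊥-elim (<⇒≱ (m<m+n (suc W) 0<i) (All.drop-just (subst (All _) (trans (sym (F-sw x≤w y≤N)) eq) (F≤ k x y))))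
  ... | ne a b = inj₁ (a , b , delay-inv (suc W) _ (trans (sym (F-ne a b)) eq) , refl)
  ... | nw a b eq′ = inj₂ (inj₁ (a , b , delay-inv (suc W) _ (trans (sym (F-nw (suc a) b eq′)) eq) ,
                       m+n≤o⇒m≤o (suc a) (≤-reflexive eq′) ,
                       cong (_, N + suc b) (trans (sym (m+n∸m≡n (suc a) x)) (cong (_∸ suc a) eq′))))
  ... | se a b eq′ = inj₂ (inj₂ (a , b ,
                       delay-inv W _ (trans (sym (F-se a b eq′)) (trans eq (cong just (sym (+-suc W i))))) ,
                       m+n≤o⇒m≤o a (≤-reflexive eq′) ,
                       cong (N + b ,_) (trans (sym (m+n∸m≡n a y)) (cong (_∸ a) eq′))))

  join : ∀ {i p} → NE i p ⊎ NW i p ⊎ SE i p → InBox (suc k) (suc W + i) p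
  join (inj₁ (a , b , eq , refl)) = trans (F-ne a b) (cong (delay (suc W)) eq)
  join (inj₂ (inj₁ (a , b , eq , le , refl))) = trans (F-nw (suc a) b (m+[n∸m]≡n le)) (cong (delay (suc W)) eq)
  join {i} (inj₂ (inj₂ (a , b , eq , le , refl))) =
    trans (F-se a b (m+[n∸m]≡n le)) (trans (cong (delay W) eq) (cong just (+-suc W i)))

  N∸<N : ∀ a → N ∸ suc a < N
  N∸<N a = s≤s (m∸n≤m w a)

  NE-NW : ∀ {i p} → NE i p → NW i p → ⊥
  NE-NW (a , b , _ , refl) (a′ , b′ , _ , _ , eq) = m+n≮m N a (subst (_< N) (sym (cong proj₁ eq)) (N∸<N a′))

  NE-SE : ∀ {i j p} → NE i p → SE j p → ⊥
  NE-SE (a , b , _ , refl) (a′ , b′ , _ , _ , eq) =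
    m+1+n≰m N (≤-trans (≤-reflexive (cong proj₂ eq)) (m∸n≤m N a′))

  NW-SE : ∀ {i j p} → NW i p → SE j p → ⊥
  NW-SE (a , b , _ , _ , refl) (a′ , b′ , _ , _ , eq) =
    m+1+n≰m N (≤-trans (≤-reflexive (cong proj₂ eq)) (m∸n≤m N a′))

  -- A copy omits some points on the axes of the original, but from stage 3 on these are empty, so
  -- nothing is lost. The bound on i ensures that `suc i` is at least 3.
  count-SE : ∀ {i c} → 2 ≤ i → Count (InBox k (suc i)) c → Count (SE i) c
  count-SE {i} 2≤i C = count-resp to from (count-image f injective C)
    where
    f : ℕ × ℕ → ℕ × ℕ
    -- `pred` because the transposed copy is anchored at x = N - 1; its value at `b = 0` never
    -- matters, by `F≥3`.
    f (a , b) = N + ℕ.pred b , N ∸ a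
    a≤N : ∀ {a b} → F k a b ≡ just (suc i) → a ≤ N
    a≤N {a} {b} eq with in-box? k a b
    ... | inj₁ (a≤w , _) = m≤n⇒m≤1+n a≤w
    ... | inj₂ out       = ⊥-elim (nothing≢just (F-outside k out) eq)
    injective : ∀ {p q} → InBox k (suc i) p → InBox k (suc i) q → f p ≡ f q → p ≡ q
    injective {a , zero}  {_}       eq _ _ = ⊥-elim (n≮0 (proj₂ (F≥3 k (s≤s 2≤i) eq)))
    injective {_} {a′ , zero} _ eq′ _ = ⊥-elim (n≮0 (proj₂ (F≥3 k (s≤s 2≤i) eq′)))
    injective {a , suc b} {a′ , suc b′} eq eq′ f≡ = cong₂ _,_
      (∸-cancelˡ-≡ (a≤N eq) (a≤N eq′) (cong proj₂ f≡)) (cong suc (+-cancelˡ-≡ N b b′ (cong proj₁ f≡)))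
    to : ∀ {p} → Image f (InBox k (suc i)) p → SE i p
    to ((a , zero)  , eq , _)    = ⊥-elim (n≮0 (proj₂ (F≥3 k (s≤s 2≤i) eq)))
    to ((a , suc b) , eq , refl) = a , b , eq , a≤N eq , refl
    from : ∀ {p} → SE i p → Image f (InBox k (suc i)) p
    from (a , b , eq , _ , p≡) = (a , suc b) , eq , p≡

  count-NE : ∀ {i c} → 3 ≤ i → Count (InBox k i) c → Count (NE i) c
  count-NE {i} 3≤i C = count-resp to from (count-image f injective C)
    where
    f : ℕ × ℕ → ℕ × ℕ
    f (a , b) = N + a , N + b
    injective : ∀ {p q} → InBox k i p → InBox k i q → f p ≡ f q → p ≡ q
    injective _ _ f≡ = cong₂ _,_ (+-cancelˡ-≡ N _ _ (cong proj₁ f≡)) (+-cancelˡ-≡ N _ _ (cong proj₂ f≡))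
    to : ∀ {p} → Image f (InBox k i) p → NE i p
    to ((a , zero)  , eq , _)    = ⊥-elim (n≮0 (proj₂ (F≥3 k 3≤i eq)))
    to ((a , suc b) , eq , refl) = a , b , eq , refl
    from : ∀ {p} → NE i p → Image f (InBox k i) p
    from (a , b , eq , p≡) = (a , suc b) , eq , p≡

  count-NW : ∀ {i c} → 3 ≤ i → Count (InBox k i) c → Count (NW i) c
  count-NW {i} 3≤i C = count-resp to from (count-image f injective C)
    where
    f : ℕ × ℕ → ℕ × ℕ
    f (a , b) = N ∸ a , N + b
    a≤N : ∀ {a b} → F k a b ≡ just i → a ≤ N
    a≤N {a} {b} eq with in-box? k a b
    ... | inj₁ (a≤w , _) = m≤n⇒m≤1+n a≤w
    ... | inj₂ out       = ⊥-elim (nothing≢just (F-outside k out) eq)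
    injective : ∀ {p q} → InBox k i p → InBox k i q → f p ≡ f q → p ≡ q
    injective eq eq′ f≡ = cong₂ _,_ (∸-cancelˡ-≡ (a≤N eq) (a≤N eq′) (cong proj₁ f≡)) (+-cancelˡ-≡ N _ _ (cong proj₂ f≡))
    to : ∀ {p} → Image f (InBox k i) p → NW i p
    to ((_     , zero)  , eq , _)    = ⊥-elim (n≮0 (proj₂ (F≥3 k 3≤i eq)))
    to ((zero  , suc b) , eq , _)    = ⊥-elim (n≮0 (proj₁ (F≥3 k 3≤i eq)))
    to ((suc a , suc b) , eq , refl) = a , b , eq , a≤N eq , refl
    from : ∀ {p} → NW i p → Image f (InBox k i) p
    from (a , b , eq , _ , p≡) = (suc a , suc b) , eq , p≡

  count-double : ∀ {i c d} → 3 ≤ i → Count (InBox k i) c → Count (InBox k (suc i)) d →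
                 Count (InBox (suc k) (suc W + i)) (c + (c + d))
  count-double 3≤i C D = count-resp join (split (≤-trans (s≤s z≤n) 3≤i))
    (count-⊎ (λ { n (inj₁ m) → NE-NW n m ; n (inj₂ m) → NE-SE n m }) (count-NE 3≤i C)
      (count-⊎ NW-SE (count-NW 3≤i C) (count-SE (≤-trans (n≤1+n 2) 3≤i) D)))

  -- Stages 1 and 2 lie on the axes, where the copies share points, so they are counted by hand.
  -- Here only the corner (N , N) appears, the stage-2 tip of the transposed copy.
  count-first : Count (InBox (suc k) (suc W + 1)) 1
  count-first = count-resp (λ { refl → join (inj₂ (inj₂ (0 , 0 , F-tip k , z≤n , cong (_, N) (sym (+-identityʳ N))))) })
                           (only ∘ split (s≤s z≤n)) (count-one (N , N))
    where
    only : ∀ {p} → NE 1 p ⊎ NW 1 p ⊎ SE 1 p → p ≡ (N , N)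
    only (inj₁ (a , b , eq , _))            with () ← F≡1 k eq
    only (inj₂ (inj₁ (a , b , eq , _)))     with () ← F≡1 k eq
    only (inj₂ (inj₂ (a , b , eq , _ , p≡))) with refl ← F≡2 k eq = trans p≡ (cong (_, N) (+-identityʳ N))

  -- The tip (N , N + 1) of the upper right copy lies on the mirror line and is also that of the
  -- upper left one, so it counts once.
  count-second : ∀ {c} → Count (InBox k 3) c → Count (InBox (suc k) (suc W + 2)) (1 + c)
  count-second C = count-resp to (from ∘ split (s≤s z≤n))
    (count-⊎ (λ { refl (a , b , _ , _ , eq) → m+1+n≰m N (≤-trans (≤-reflexive (cong proj₂ eq)) (m∸n≤m N a)) })
      (count-one (N + 0 , N + 1)) (count-SE ≤-refl C))
    where
    to : ∀ {p} → p ≡ (N + 0 , N + 1) ⊎ SE 2 p → InBox (suc k) (suc W + 2) p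
    to (inj₁ refl) = join (inj₁ (0 , 0 , F-tip k , refl))
    to (inj₂ s)    = join (inj₂ (inj₂ s))
    from : ∀ {p} → NE 2 p ⊎ NW 2 p ⊎ SE 2 p → p ≡ (N + 0 , N + 1) ⊎ SE 2 p
    from (inj₁ (a , b , eq , p≡)) with refl ← F≡2 k eq = inj₁ p≡
    from (inj₂ (inj₁ (a , b , eq , _))) with () ← F≡2 k eq
    from (inj₂ (inj₂ s)) = inj₂ s

-- The recurrence

2^k≡suc-width : ∀ k → 2 ^ k ≡ suc (width k)
2^k≡suc-width zero    = refl
2^k≡suc-width (suc k) = trans (cong (2 *_) (2^k≡suc-width k))
  (cong suc (trans (cong (_+_ (width k)) (+-identityʳ (suc (width k)))) (+-suc (width k) (width k))))

-- The two upper copies reach their last stage together, while the transposed one, a stage ahead,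
-- has already finished and adds nothing. So the number doubles.
last-stage : ∀ k → Count (InBox (suc k) (suc (width (suc (suc k))))) (2 ^ k)
-- The search evaluates to the single point (1 , 2).
last-stage zero    = inBox-count 1 4
last-stage (suc k) = subst (λ n → Count (InBox (suc (suc k)) n) (2 ^ suc k))
  (cong suc (+-suc W W))
  (count-double (s≤s (s≤s (s≤s z≤n))) (last-stage k) (count-none λ {p} → none p))
  where
  open Doubling (suc k)
  W : ℕ
  W = width (suc (suc k))
  none : ∀ p → ¬ InBox (suc k) (suc (suc W)) p
  none (x , y) eq = 1+n≰n (All.drop-just (subst (All _) eq (F≤ (suc k) x y)))

t-power : ∀ k → t (suc (width (suc k))) ≡ 2 ^ suc k
t-power zero    = refl
t-power (suc k) = trans
  (t≡4* (suc k) (s≤s (s≤s (s≤s z≤n))) ≤-refl (last-stage k))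
  (*-assoc 2 2 (2 ^ k))

t-step : ∀ k i → 1 ≤ i → i < suc (width (suc k)) → t (suc (width (suc k)) + i) ≡ 2 * t i + t (suc i)
t-step k i 1≤i i< = go i 1≤i i<
  where
  open Doubling k
  W : ℕ
  W = width (suc k)
  bound : ∀ {i} → i < suc W → suc W + i ≤ suc (width (suc (suc k)))
  bound i< = s≤s (≤-trans (+-monoʳ-≤ W (<⇒≤ i<)) (≤-reflexive (+-suc W W)))
  late : ∀ {i} → 1 ≤ i → 3 ≤ suc W + i
  late 1≤i = s≤s (+-mono-≤ {1} (s≤s z≤n) 1≤i)
  go : ∀ i → 1 ≤ i → i < suc W → t (suc W + i) ≡ 2 * t i + t (suc i)
  -- Both sides evaluate to 4.
  go 1 1≤i i< = t≡4* (suc k) (late 1≤i) (bound i<) count-first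
  go 2 1≤i i< = trans (t≡4* (suc k) (late 1≤i) (bound i<) (count-second (inBox-count k 3)))
    -- The summand 4 is the value of `2 * t 2`.
    (trans (*-distribˡ-+ 4 1 c) (cong (_+_ 4) (sym (t≡4* k ≤-refl i< (inBox-count k 3)))))
    where c = length (inBox-list k 3)
  go i@(suc (suc (suc _))) 1≤i i< = begin
    t (suc W + i)            ≡⟨ t≡4* (suc k) (late 1≤i) (bound i<) (count-double 3≤i (inBox-count k i) (inBox-count k (suc i))) ⟩
    4 * (c + (c + d))        ≡⟨ solve 2 (λ c d → con 4 :* (c :+ (c :+ d)) := con 2 :* (con 4 :* c) :+ con 4 :* d) refl c d ⟩
    2 * (4 * c) + 4 * d      ≡⟨ cong₂ (λ a b → 2 * a + b) (t≡4* k 3≤i (<⇒≤ i<) (inBox-count k i)) (t≡4* k (m≤n⇒m≤1+n 3≤i) i< (inBox-count k (suc i))) ⟨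
    2 * t i + t (suc i)      ∎
    where
    open ≡-Reasoning
    open +-*-Solver
    3≤i : 3 ≤ i
    3≤i = s≤s (s≤s (s≤s z≤n))
    c d : ℕ
    c = length (inBox-list k i)
    d = length (inBox-list k (suc i))

theorem2 : (t 1 ≡ 1) × (∀ (k : ℕ) → 1 ≤ k → (t (2 ^ k) ≡ 2 ^ k) × (∀ (i : ℕ) → 1 ≤ i → i < 2 ^ k → t (2 ^ k + i) ≡ 2 * t i + t (suc i)))
theorem2 = refl , λ { (suc k) _ → trans (cong t (2^k≡suc-width (suc k))) (t-power k)
                                , λ i 1≤i i< → trans (cong (λ n → t (n + i)) (2^k≡suc-width (suc k)))
                                                 (t-step k i 1≤i (subst (i <_) (2^k≡suc-width (suc k)) i<)) }
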